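{- For every finite simple graph $G$, $$\alpha_1(G) + \tau_B(G) \leq \frac{|V(G)|^2}{4}.$$ Moreover, equality holds if and only if $G$ is a join of a collection of complete balanced bipartite graphs.
   Context: All graphs are finite and simple. A set of edges $T \subseteq E(G)$ of a graph $G$ is triangle-independent if $T$ contains at most one edge from each triangle in $G$. $\alpha_1(G)$ denotes the maximum size of a triangle-independent set in $G$. $\tau_B(G)$ denotes the minimum size of a set $F \subseteq E(G)$ such that $G \setminus F$ (the graph obtained from $G$ by deleting the edges in $F$) is bipartite. The join $H_1 \vee H_2 \vee \cdots \vee H_k$ of a collection of vertex-disjoint graphs $H_1,\dots,H_k$ is the graph obtained from their union by joining, for all $i \neq j$, every vertex of $H_i$ to every vertex of $H_j$ by an edge (a single graph, $k=1$, is allowed; the graph with no vertices is regarded as the join of the empty collection). A complete balanced bipartite graph is a graph $K_{t,t}$ with $t \geq 1$. -}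

module Defs where

open import Data.Bool.Base using (Bool; true)
import Data.Bool.Properties as Bool
open import Data.Fin.Base using (Fin; _<_)
open import Data.Fin.Properties using (_≟_; _<?_; <-cmp; all?; any?)
open import Data.Fin.Subset using (Subset; _∈_; ∣_∣; ⊥; ⊤)
open import Data.Fin.Subset.Properties using (_∈?_; anySubset?; ∣p∣≤n; ∉⊥; ∈⊤)
open import Data.List.Base using (List; allFin; cartesianProduct; filter; length; lookup)
open import Data.List.Membership.Propositional using () renaming (_∈_ to _∈ₗ_)
open import Data.List.Membership.Propositional.Properties
  using (∈-allFin; ∈-cartesianProduct⁺; ∈-filter⁺)
open import Data.List.Relation.Unary.Any using (index)
open import Data.List.Relation.Unary.Any.Properties using (lookup-index)
open import Data.Nat.Base as ℕ using (ℕ; _∸_; _≤_)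
open import Data.Nat.Induction using (<-wellFounded)
import Data.Nat.Properties as ℕ
open import Data.Product.Base using (Σ; ∃; ∃-syntax; _×_; _,_; proj₁)
import Data.Product.Properties as Product
open import Data.Sum.Base using (_⊎_; inj₁; inj₂)
import Data.Sum.Base as Sum
open import Data.Vec.Base as Vec using (tabulate)
open import Data.Vec.Properties using (lookup∘tabulate)
open import Function.Base using (_∘_)
open import Function.Bundles using (_⇔_; _↔_; Inverse)
open import Induction.WellFounded using (Acc; acc)
open import Level using (0ℓ)
open import Relation.Binary.Core using (Rel)
open import Relation.Binary.Definitions using (Decidable; Symmetric; tri<; tri≈; tri>)
open import Relation.Binary.PropositionalEquality
  using (_≡_; _≢_; refl; sym; subst₂)
open import Relation.Nullary.Decidable
  using (Dec; yes; no; map′; ¬?; _×-dec_; _⊎-dec_; _→-dec_)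
open import Relation.Nullary.Negation using (¬_; contradiction)
open import Relation.Unary using (Pred) renaming (Decidable to Decidable₁)

-- Classically every graph has decidable adjacency; here it is a field, and the
-- extremal edge sets below are found by search.
record Graph (V : Set) : Set₁ where
  infix 4 _~_ _~?_
  field
    _~_      : Rel V 0ℓ
    _~?_     : Decidable _~_
    ~-sym    : Symmetric _~_
    ~-irrefl : ∀ {v} → ¬ (v ~ v)

open Graph public using () renaming (_~_ to Adj; _~?_ to adj?)

record _≅_ {V W : Set} (G : Graph V) (H : Graph W) : Set where
  field
    bijection : V ↔ W
    adjacency : ∀ u v → Adj G u v ⇔ Adj H (Inverse.to bijection u) (Inverse.to bijection v)

Bipartite : ∀ {V} → Graph V → Set
Bipartite {V} G = Σ (V → Bool) λ side → ∀ u v → Adj G u v → side u ≢ side v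

data CrossAdj {A B : Set} : Rel (A ⊎ B) 0ℓ where
  left-right : ∀ {a b} → CrossAdj (inj₁ a) (inj₂ b)
  right-left : ∀ {a b} → CrossAdj (inj₂ b) (inj₁ a)

K : (s t : ℕ) → Graph (Fin s ⊎ Fin t)
K s t = record
  { _~_      = CrossAdj
  ; _~?_     = λ where
      (inj₁ _) (inj₁ _) → no λ ()
      (inj₁ _) (inj₂ _) → yes left-right
      (inj₂ _) (inj₁ _) → yes right-left
      (inj₂ _) (inj₂ _) → no λ ()
  ; ~-sym    = λ where
      left-right → right-left
      right-left → left-right
  ; ~-irrefl = λ { {inj₁ _} () ; {inj₂ _} () }
  }

module _ {k : ℕ} {V : Fin k → Set} (H : ∀ i → Graph (V i)) where

  data JoinAdj : Rel (Σ (Fin k) V) 0ℓ where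
    within : ∀ {i u v} → Adj (H i) u v → JoinAdj (i , u) (i , v)
    across : ∀ {i j u v} → i ≢ j → JoinAdj (i , u) (j , v)

  Join : Graph (Σ (Fin k) V)
  Join = record
    { _~_      = JoinAdj
    ; _~?_     = dec
    ; ~-sym    = λ where
        (within p)   → within (Graph.~-sym (H _) p)
        (across i≢j) → across (i≢j ∘ sym)
    ; ~-irrefl = λ where
        (within p)   → Graph.~-irrefl (H _) p
        (across i≢i) → i≢i refl
    }
    where
    dec : Decidable JoinAdj
    dec (i , u) (j , v) with i ≟ j
    ... | no i≢j = yes (across i≢j)
    ... | yes refl = map′ within
      (λ { (within p) → p ; (across i≢i) → contradiction refl i≢i })
      (adj? (H i) u v)

IsJoinOfCompleteBalancedBipartite : ∀ {V} → Graph V → Set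
IsJoinOfCompleteBalancedBipartite G =
  ∃[ k ] Σ (Fin k → ℕ) λ t →
    (∀ i → 1 ≤ t i) × G ≅ Join (λ i → K (t i) (t i))

module _ {m : ℕ} {P : Pred (Subset m) 0ℓ} (P? : Decidable₁ P) where

  private
    minimise : (f : Subset m → ℕ) → ∃ P →
               ∃[ p ] (P p × (∀ q → P q → f p ≤ f q))
    minimise f (p , Pp) = go p Pp (<-wellFounded (f p))
      where
      go : ∀ p → P p → Acc ℕ._<_ (f p) → ∃[ p ] (P p × (∀ q → P q → f p ≤ f q))
      go p Pp (acc rs) with anySubset? (λ q → P? q ×-dec (f q ℕ.<? f p))
      ... | yes (q , Pq , q<p) = go q Pq (rs q<p)
      ... | no none = p , Pp , λ q Pq → ℕ.≮⇒≥ (λ q<p → none (q , Pq , q<p))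

  smallest : ∃ P → ∃[ p ] (P p × (∀ q → P q → ∣ p ∣ ≤ ∣ q ∣))
  smallest = minimise ∣_∣

  largest : ∃ P → ∃[ p ] (P p × (∀ q → P q → ∣ q ∣ ≤ ∣ p ∣))
  largest ex with minimise (λ p → m ∸ ∣ p ∣) ex
  ... | p , Pp , least = p , Pp , λ q Pq → ℕ.∸-cancelʳ-≤ (∣p∣≤n q) (least q Pq)

module _ {n : ℕ} (G : Graph (Fin n)) where

  open Graph G

  private
    listed? : Decidable₁ {A = Fin n × Fin n} (λ (u , v) → u < v × u ~ v)
    listed? (u , v) = u <? v ×-dec u ~? v

  -- Each edge is listed exactly once, smaller endpoint first.
  edges : List (Fin n × Fin n)
  edges = filter listed? (cartesianProduct (allFin n) (allFin n))

  Edge : Set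
  Edge = Fin (length edges)

  EdgeSet : Set
  EdgeSet = Subset (length edges)

  Joins : Edge → Fin n → Fin n → Set
  Joins e u v = lookup edges e ≡ (u , v) ⊎ lookup edges e ≡ (v , u)

  joins? : ∀ e u v → Dec (Joins e u v)
  joins? e u v = (lookup edges e ≟₂ (u , v)) ⊎-dec (lookup edges e ≟₂ (v , u))
    where _≟₂_ = Product.≡-dec _≟_ _≟_

  joining-edge : ∀ {u v} → u ~ v → ∃[ e ] Joins e u v
  joining-edge {u} {v} u~v with <-cmp u v
  ... | tri< u<v _ _ = index ∈es , inj₁ (sym (lookup-index ∈es))
    where
    ∈es : (u , v) ∈ₗ edges
    ∈es = ∈-filter⁺ listed? (∈-cartesianProduct⁺ (∈-allFin u) (∈-allFin v)) (u<v , u~v)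
  ... | tri≈ _ refl _ = contradiction u~v ~-irrefl
  ... | tri> _ _ v<u = index ∈es , inj₂ (sym (lookup-index ∈es))
    where
    ∈es : (v , u) ∈ₗ edges
    ∈es = ∈-filter⁺ listed? (∈-cartesianProduct⁺ (∈-allFin v) (∈-allFin u)) (v<u , ~-sym u~v)

  Triangle : Fin n → Fin n → Fin n → Set
  Triangle u v w = u ~ v × v ~ w × w ~ u

  EdgeOfTriangle : Edge → Fin n → Fin n → Fin n → Set
  EdgeOfTriangle e u v w = Joins e u v ⊎ Joins e v w ⊎ Joins e w u

  TriangleIndependent : EdgeSet → Set
  TriangleIndependent T =
    ∀ u v w → Triangle u v w →
    ∀ e f → e ∈ T → f ∈ T →
    EdgeOfTriangle e u v w → EdgeOfTriangle f u v w → e ≡ f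

  triangleIndependent? : Decidable₁ TriangleIndependent
  triangleIndependent? T =
    all? λ u → all? λ v → all? λ w →
    (u ~? v ×-dec v ~? w ×-dec w ~? u) →-dec
    (all? λ e → all? λ f →
      (e ∈? T) →-dec (f ∈? T) →-dec
      edgeOfTriangle? e u v w →-dec edgeOfTriangle? f u v w →-dec (e ≟ f))
    where
    edgeOfTriangle? : ∀ e u v w → Dec (EdgeOfTriangle e u v w)
    edgeOfTriangle? e u v w = joins? e u v ⊎-dec joins? e v w ⊎-dec joins? e w u

  infixl 6 _∖_

  _∖_ : EdgeSet → Graph (Fin n)
  _∖_ F = record
    { _~_      = λ u v → u ~ v × ¬ (∃[ e ] (e ∈ F × Joins e u v))
    ; _~?_     = λ u v → u ~? v ×-dec ¬? (any? λ e → (e ∈? F) ×-dec joins? e u v)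
    ; ~-sym    = λ (u~v , kept) →
        ~-sym u~v , λ (e , e∈F , j) → kept (e , e∈F , Sum.swap j)
    ; ~-irrefl = λ (v~v , _) → ~-irrefl v~v
    }

bipartite? : ∀ {n} (G : Graph (Fin n)) → Dec (Bipartite G)
bipartite? G = map′
  (λ (s , proper) → Vec.lookup s , proper)
  (λ (c , proper) → tabulate c , λ u v u~v → subst₂ _≢_
    (sym (lookup∘tabulate c u)) (sym (lookup∘tabulate c v)) (proper u v u~v))
  (anySubset? λ s → all? λ u → all? λ v →
    adj? G u v →-dec ¬? (Vec.lookup s u Bool.≟ Vec.lookup s v))

module _ {n : ℕ} (G : Graph (Fin n)) where

  maximumTriangleIndependent :
    ∃[ T ] (TriangleIndependent G T ×
            (∀ T′ → TriangleIndependent G T′ → ∣ T′ ∣ ≤ ∣ T ∣))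
  maximumTriangleIndependent = largest (triangleIndependent? G)
    (⊥ , λ _ _ _ _ _ _ e∈⊥ → contradiction e∈⊥ ∉⊥)

  α₁ : ℕ
  α₁ = ∣ proj₁ maximumTriangleIndependent ∣

  minimumBipartiteDeletion :
    ∃[ F ] (Bipartite (G ∖ F) ×
            (∀ F′ → Bipartite (G ∖ F′) → ∣ F ∣ ≤ ∣ F′ ∣))
  minimumBipartiteDeletion = smallest (λ F → bipartite? (G ∖ F))
    (⊤ , (λ _ → true) , λ u v (u~v , kept) _ →
      let e , j = joining-edge G u~v in kept (e , ∈⊤ , j))

  τB : ℕ
  τB = ∣ proj₁ minimumBipartiteDeletion ∣

{-# OPTIONS --safe #-}

-- Fix a triangle-independent T and write N(v) for T-neighbourhoods; each N(v) is an
-- independent set of G. A colouring leaving few edges uncut is built by repeatedly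
-- choosing an edge uv of T, placing N(u) and N(v) on opposite sides in the better of the
-- two ways, and continuing with the remaining vertices R. With S = N(u) ∪ N(v), such a
-- step is affordable as soon as
--   loss = 2 t(S,S) + 4 t(S,R) ≤ |S|² + 2 ā(S,R) = gain,
-- where t and ā count ordered pairs that are in T, respectively non-adjacent in G.
-- Summed over all uv in T, loss is at most gain. By AM-GM on the degrees this reduces to
-- an inequality for each u, w not joined in T: with p(u,w) the number of y in N(u) not
-- adjacent to w and q(u,w) = |N(u) ∖ N(w)| ≥ p(u,w), the number e of T-walks u v x w
-- satisfies 2e ≤ 2 p(u,w) p(w,u) ≤ p(u,w) q(u,w) + p(w,u) q(w,u).
-- In the case of equality every edge of T is tight, and by induction every vertex of R has
-- a T-neighbour in R. If some x in S had a T-neighbour w in R, the T-walk u v x w would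
-- extend to some w′ in R, making the inequality above strict; so t(S,R) = 0, and loss =
-- gain forces S to be a balanced complete bipartite graph joined to all of R.
-- Conversely, any colouring of n vertices has at least n²/2 monochromatic ordered pairs,
-- and in a join of graphs K_{t,t} the edges inside the factors are as many as the
-- non-adjacent ordered pairs (loops included) halved.
module Submission where

open import Defs
open import Data.Fin.Base using (Fin)
open import Data.Nat.Base using (ℕ; _+_; _*_; _^_; _≤_)
open import Data.Product.Base using (_×_)
open import Function.Bundles using (_⇔_)
open import Relation.Binary.PropositionalEquality using (_≡_)

open import Data.Bool.Base using (Bool; true; false; not; _∧_; _∨_; _xor_; if_then_else_)
import Data.Bool.Properties as Bool
open import Data.Empty using (⊥; ⊥-elim)
open import Data.Fin.Base as Fin using (zero; suc; cast)
open import Data.Fin.Permutation using (Permutation′; _⟨$⟩ʳ_)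
open import Data.Fin.Properties as Fin using (any?; cast-trans; cast-is-id)
open import Data.Fin.Subset using (∣_∣) renaming (_∈_ to _∈ₛ_)
open import Data.Fin.Subset.Properties using () renaming (_∈?_ to _∈ₛ?_)
open import Data.List.Base
  using (List; []; _∷_; _++_; length; map; filter; filterᵇ; lookup; allFin; tabulate; cartesianProduct)
open import Data.List.Membership.Propositional using (_∈_; find; lose)
open import Data.List.Membership.Propositional.Properties using (∈-lookup; ∈-allFin; ∈-filter⁺; ∈-filter⁻)
open import Data.List.Properties using (map-++; length-tabulate)
open import Data.List.Relation.Unary.All as All using ()
open import Data.List.Relation.Unary.AllPairs using (_∷_)
open import Data.List.Relation.Unary.Any as Any using (here; there; index)
open import Data.List.Relation.Unary.Any.Properties using (lookup-index)
open import Data.List.Relation.Unary.Unique.Propositional using (Unique)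
open import Data.List.Relation.Unary.Unique.Propositional.Properties using (filter⁺; allFin⁺; cartesianProduct⁺)
open import Data.Nat.Base using (zero; suc; _<_; z≤n; s≤s; >-nonZero)
open import Data.Nat.ListAction using (sum)
open import Data.Nat.ListAction.Properties using (sum-++)
open import Data.Nat.Properties hiding (_≟_)
open import Data.Nat.Tactic.RingSolver using (solve-∀)
open import Data.Product.Base using (Σ; ∃-syntax; _,_; proj₁; proj₂; uncurry)
import Data.Product.Properties as Product
open import Data.Sum.Base using (_⊎_; inj₁; inj₂; [_,_]′; swap)
open import Data.Sum.Properties using (swap-involutive)
import Data.Vec.Base as Vec
import Data.Vec.Properties as Vec
open import Algebra.Properties.CommutativeMonoid.Sum +-0-commutativeMonoid
  using (sum-permute) renaming (sum to sumᶠ)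
open import Algebra.Properties.CommutativeSemigroup +-commutativeSemigroup using (interchange; x∙yz≈y∙xz)
open import Function.Base using (_∘_; flip; const; id)
open import Function.Bundles using (Equivalence; Inverse; _↔_; mk⇔; mk⤖; mk↔ₛ′)
open import Function.Properties.Bijection using (⤖⇒↔)
open import Function.Properties.Inverse using (↔-sym)
open import Relation.Binary.Definitions using (DecidableEquality; tri<; tri≈; tri>)
open import Relation.Binary.PropositionalEquality
  using (_≢_; refl; sym; trans; cong; cong₂; subst; subst₂; module ≡-Reasoning)
open import Relation.Nullary.Decidable
  using (Dec; yes; no; does; dec-true; dec-false; does-⇔; _×-dec_)
open import Relation.Nullary.Negation using (¬_; contradiction)
open import Relation.Unary using (Decidable)

-- Finite sums over lists.

private variable
  A B : Set
  xs ys : List A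

⟦_⟧ : Bool → ℕ
⟦ true ⟧  = 1
⟦ false ⟧ = 0

1≡⟦b⟧+⟦not-b⟧ : ∀ b → 1 ≡ ⟦ b ⟧ + ⟦ not b ⟧
1≡⟦b⟧+⟦not-b⟧ true  = refl
1≡⟦b⟧+⟦not-b⟧ false = refl

n+n≡2*n : ∀ n → n + n ≡ 2 * n
n+n≡2*n = solve-∀

∑ : List A → (A → ℕ) → ℕ
∑ xs f = sum (map f xs)

syntax ∑ xs (λ x → e) = ∑[ x ← xs ] e
infixr 5 ∑

∑-cong : ∀ {f g : A → ℕ} → (∀ {x} → x ∈ xs → f x ≡ g x) → ∑ xs f ≡ ∑ xs g
∑-cong {xs = []}     eq = refl
∑-cong {xs = x ∷ xs} eq = cong₂ _+_ (eq (here refl)) (∑-cong (eq ∘ there))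

∑-mono-≤ : ∀ {f g : A → ℕ} → (∀ {x} → x ∈ xs → f x ≤ g x) → ∑ xs f ≤ ∑ xs g
∑-mono-≤ {xs = []}     le = z≤n
∑-mono-≤ {xs = x ∷ xs} le = +-mono-≤ (le (here refl)) (∑-mono-≤ (le ∘ there))

∑-mono-< : ∀ {f g : A → ℕ} → (∀ {x} → x ∈ xs → f x ≤ g x) →
           ∀ {z} → z ∈ xs → f z < g z → ∑ xs f < ∑ xs g
∑-mono-< {xs = x ∷ xs} le (here refl) lt = +-mono-<-≤ lt (∑-mono-≤ (le ∘ there))
∑-mono-< {xs = x ∷ xs} le (there z∈)  lt = +-mono-≤-< (le (here refl)) (∑-mono-< (le ∘ there) z∈ lt)

∑-distrib-+ : ∀ xs (f g : A → ℕ) → (∑[ x ← xs ] (f x + g x)) ≡ ∑ xs f + ∑ xs g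
∑-distrib-+ []       f g = refl
∑-distrib-+ (x ∷ xs) f g =
  trans (cong (f x + g x +_) (∑-distrib-+ xs f g)) (interchange (f x) (g x) (∑ xs f) (∑ xs g))

*-distribˡ-∑ : ∀ k xs (f : A → ℕ) → k * ∑ xs f ≡ (∑[ x ← xs ] (k * f x))
*-distribˡ-∑ k []       f = *-zeroʳ k
*-distribˡ-∑ k (x ∷ xs) f =
  trans (*-distribˡ-+ k (f x) (∑ xs f)) (cong (k * f x +_) (*-distribˡ-∑ k xs f))

*-distribʳ-∑ : ∀ k xs (f : A → ℕ) → ∑ xs f * k ≡ (∑[ x ← xs ] (f x * k))
*-distribʳ-∑ k []       f = refl
*-distribʳ-∑ k (x ∷ xs) f =
  trans (*-distribʳ-+ k (f x) (∑ xs f)) (cong (f x * k +_) (*-distribʳ-∑ k xs f))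

∑-zero : (xs : List A) → (∑[ x ← xs ] 0) ≡ 0
∑-zero []       = refl
∑-zero (x ∷ xs) = ∑-zero xs

∑-one : (xs : List A) → (∑[ x ← xs ] 1) ≡ length xs
∑-one []       = refl
∑-one (x ∷ xs) = cong suc (∑-one xs)

∑-swap : ∀ xs ys (f : A → B → ℕ) →
         (∑[ x ← xs ] ∑[ y ← ys ] f x y) ≡ (∑[ y ← ys ] ∑[ x ← xs ] f x y)
∑-swap []       ys f = sym (∑-zero ys)
∑-swap (x ∷ xs) ys f =
  trans (cong (∑ ys (f x) +_) (∑-swap xs ys f)) (sym (∑-distrib-+ ys (f x) _))

∑-product : ∀ xs ys (f : A → ℕ) (g : B → ℕ) →
            ∑ xs f * ∑ ys g ≡ (∑[ x ← xs ] ∑[ y ← ys ] (f x * g y))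
∑-product xs ys f g = trans (*-distribʳ-∑ (∑ ys g) xs f)
  (∑-cong {xs = xs} λ {x} _ → *-distribˡ-∑ (f x) ys g)

∑-filter : ∀ {P : A → Set} (P? : Decidable P) xs (f : A → ℕ) →
           ∑ (filter P? xs) f ≡ (∑[ x ← xs ] (⟦ does (P? x) ⟧ * f x))
∑-filter P? []       f = refl
∑-filter P? (x ∷ xs) f with does (P? x)
... | true  = cong₂ _+_ (sym (+-identityʳ (f x))) (∑-filter P? xs f)
... | false = ∑-filter P? xs f

∑-filterᵇ : ∀ p xs (f : A → ℕ) → ∑ (filterᵇ p xs) f ≡ (∑[ x ← xs ] (⟦ p x ⟧ * f x))
∑-filterᵇ p = ∑-filter (Bool.T? ∘ p)

∑-partition : ∀ p xs (f : A → ℕ) →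
              ∑ xs f ≡ ∑ (filterᵇ p xs) f + ∑ (filterᵇ (not ∘ p) xs) f
∑-partition p []       f = refl
∑-partition p (x ∷ xs) f with p x
... | true  = trans (cong (f x +_) (∑-partition p xs f)) (sym (+-assoc (f x) _ _))
... | false = trans (cong (f x +_) (∑-partition p xs f)) (x∙yz≈y∙xz (f x) (∑ (filterᵇ p xs) f) _)

∑-length-filterᵇ : ∀ p (xs : List A) → length (filterᵇ p xs) ≡ (∑[ x ← xs ] ⟦ p x ⟧)
∑-length-filterᵇ p xs = trans (sym (∑-one (filterᵇ p xs)))
  (trans (∑-filterᵇ p xs _) (∑-cong {xs = xs} λ _ → *-identityʳ _))

length-partition : ∀ p (xs : List A) →
  length xs ≡ length (filterᵇ p xs) + length (filterᵇ (not ∘ p) xs)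
length-partition p xs = begin
  length xs ≡⟨ ∑-one xs ⟨
  (∑[ x ← xs ] 1) ≡⟨ ∑-partition p xs _ ⟩
  (∑[ x ← filterᵇ p xs ] 1) + (∑[ x ← filterᵇ (not ∘ p) xs ] 1)
    ≡⟨ cong₂ _+_ (∑-one (filterᵇ p xs)) (∑-one (filterᵇ (not ∘ p) xs)) ⟩
  length (filterᵇ p xs) + length (filterᵇ (not ∘ p) xs) ∎
  where open ≡-Reasoning

∈-filterᵇ⁻ : ∀ p xs {x : A} → x ∈ filterᵇ p xs → x ∈ xs × p x ≡ true
∈-filterᵇ⁻ p xs x∈ with ∈-filter⁻ (Bool.T? ∘ p) x∈
... | x∈xs , px = x∈xs , Equivalence.to Bool.T-≡ px

∈-filterᵇ⁺ : ∀ p {x : A} → x ∈ xs → p x ≡ true → x ∈ filterᵇ p xs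
∈-filterᵇ⁺ p x∈ px = ∈-filter⁺ (Bool.T? ∘ p) x∈ (Equivalence.from Bool.T-≡ px)

∉-filterᵇ : ∀ p xs {x : A} → x ∈ filterᵇ (not ∘ p) xs → x ∈ xs × p x ≡ false
∉-filterᵇ p xs x∈ with ∈-filterᵇ⁻ (not ∘ p) xs x∈
... | x∈xs , npx = x∈xs , Bool.not-injective npx

-- Counting ordered pairs in a Boolean relation.

infix 8 #_
#_ : List A → ℕ
#_ = length

pairs : (A → A → Bool) → List A → List A → ℕ
pairs r xs ys = ∑[ x ← xs ] ∑[ y ← ys ] ⟦ r x y ⟧

pairs-cong : ∀ {r s : A → A → Bool} {xs ys} →
             (∀ {x y} → x ∈ xs → y ∈ ys → r x y ≡ s x y) → pairs r xs ys ≡ pairs s xs ys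
pairs-cong {xs = xs} {ys} eq = ∑-cong {xs = xs} λ x∈ → ∑-cong {xs = ys} λ y∈ → cong ⟦_⟧ (eq x∈ y∈)

pairs-flip : ∀ (r : A → A → Bool) → (∀ x y → r x y ≡ r y x) → ∀ xs ys →
             pairs r xs ys ≡ pairs r ys xs
pairs-flip r r-sym xs ys = trans (∑-swap xs ys _)
  (∑-cong {xs = ys} λ {y} _ → ∑-cong {xs = xs} λ {x} _ → cong ⟦_⟧ (r-sym x y))

pairs-complement : ∀ (r : A → A → Bool) xs ys →
                   # xs * # ys ≡ pairs r xs ys + pairs (λ x y → not (r x y)) xs ys
pairs-complement r xs ys = begin
  # xs * # ys ≡⟨ cong₂ _*_ (∑-one xs) (∑-one ys) ⟨
  (∑[ x ← xs ] 1) * (∑[ y ← ys ] 1) ≡⟨ ∑-product xs ys _ _ ⟩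
  (∑[ x ← xs ] ∑[ y ← ys ] 1)
    ≡⟨ ∑-cong {xs = xs} (λ {x} _ → trans (∑-cong {xs = ys} λ {y} _ → 1≡⟦b⟧+⟦not-b⟧ (r x y)) (∑-distrib-+ ys _ _)) ⟩
  (∑[ x ← xs ] ((∑[ y ← ys ] ⟦ r x y ⟧) + (∑[ y ← ys ] ⟦ not (r x y) ⟧)))
    ≡⟨ ∑-distrib-+ xs _ _ ⟩
  pairs r xs ys + pairs (λ x y → not (r x y)) xs ys ∎
  where open ≡-Reasoning

pairs-partition : ∀ (r : A → A → Bool) → (∀ x y → r x y ≡ r y x) → ∀ p xs →
  let in′ = filterᵇ p xs; out = filterᵇ (not ∘ p) xs in
  pairs r xs xs ≡ pairs r in′ in′ + 2 * pairs r in′ out + pairs r out out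
pairs-partition r r-sym p xs = begin
  pairs r xs xs ≡⟨ ∑-partition p xs _ ⟩
  pairs r in′ xs + pairs r out xs ≡⟨ cong₂ _+_ (split in′) (split out) ⟩
  (pairs r in′ in′ + pairs r in′ out) + (pairs r out in′ + pairs r out out)
    ≡⟨ cong (λ k → pairs r in′ in′ + pairs r in′ out + (k + pairs r out out)) (pairs-flip r r-sym out in′) ⟩
  (pairs r in′ in′ + pairs r in′ out) + (pairs r in′ out + pairs r out out)
    ≡⟨ arith (pairs r in′ in′) (pairs r in′ out) (pairs r out out) ⟩
  pairs r in′ in′ + 2 * pairs r in′ out + pairs r out out ∎
  where
  open ≡-Reasoning
  in′ = filterᵇ p xs
  out = filterᵇ (not ∘ p) xs
  split : ∀ ys → pairs r ys xs ≡ pairs r ys in′ + pairs r ys out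
  split ys = trans (∑-cong {xs = ys} λ _ → ∑-partition p xs _) (∑-distrib-+ ys _ _)
  arith : ∀ a b c → (a + b) + (b + c) ≡ a + 2 * b + c
  arith = solve-∀

pairs-zero : ∀ {r : A → A → Bool} {xs ys} → (∀ {x y} → x ∈ xs → y ∈ ys → r x y ≡ false) →
             pairs r xs ys ≡ 0
pairs-zero {xs = xs} {ys} eq = trans
  (∑-cong {xs = xs} λ x∈ → trans (∑-cong {xs = ys} λ y∈ → cong ⟦_⟧ (eq x∈ y∈)) (∑-zero ys))
  (∑-zero xs)

-- Colouring by peeling off two independent classes.

uncut : ∀ {V : Set} → (V → V → Bool) → (V → Bool) → V → V → Bool
uncut a c x y = a x y ∧ not (c x xor c y)

uncut-sym : ∀ {V : Set} (a : V → V → Bool) → (∀ x y → a x y ≡ a y x) →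
            ∀ c x y → uncut a c x y ≡ uncut a c y x
uncut-sym a a-sym c x y = cong₂ _∧_ (a-sym x y) (cong not (Bool.xor-comm (c x) (c y)))

module Peel {V : Set} (a t : V → V → Bool)
            (a-sym : ∀ x y → a x y ≡ a y x) (t-sym : ∀ x y → t x y ≡ t y x) where

  non : V → V → Bool
  non x y = not (a x y)

  nbrs : V → V → V → Bool
  nbrs u v x = t u x ∨ t v x

  -- Ordered pairs count each edge twice, so on a list without repetitions this is four times the
  -- number of T-edges plus monochromatic edges. The target is `# xs * # xs`.
  cost : List V → (V → Bool) → ℕ
  cost xs c = 2 * pairs t xs xs + 2 * pairs (uncut a c) xs xs

  rest : (V → Bool) → List V → List V
  rest s = filterᵇ (not ∘ s)

  -- Let S and R be the parts inside and outside `s`. The square of `# xs` exceeds that of |R| by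
  -- |S|² + 2|S||R|. Of the mixed term, the uncut edges between S and R in the better colouring use
  -- up at most 2 `pairs a` S R, which leaves 2 `pairs non` S R in the gain. The loss is the exact
  -- growth of 2 `pairs t`.
  gain loss : (V → Bool) → List V → ℕ
  gain s xs = # filterᵇ s xs * # filterᵇ s xs + 2 * pairs non (filterᵇ s xs) (rest s xs)
  loss s xs = 2 * pairs t (filterᵇ s xs) (filterᵇ s xs) + 4 * pairs t (filterᵇ s xs) (rest s xs)

  -- The classes are arbitrary and not only T-neighbourhoods, because a list without T-edges is
  -- treated by peeling off a single vertex, with the second class empty.
  module _ (α β : V → Bool)
           (α-indep : ∀ {x y} → α x ≡ true → α y ≡ true → a x y ≡ false)
           (β-indep : ∀ {x y} → β x ≡ true → β y ≡ true → a x y ≡ false)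
           (xs : List V) (c′ : V → Bool) where
    private
      s : V → Bool
      s x = α x ∨ β x
      in′ out : List V
      in′ = filterᵇ s xs
      out = rest s xs

      colour : Bool → V → Bool
      colour b x = if α x then b else if β x then not b else c′ x

      colour-out : ∀ b {x} → x ∈ out → colour b x ≡ c′ x
      colour-out b {x} x∈ with α x | β x | proj₂ (∉-filterᵇ s xs x∈)
      ... | false | false | _ = refl

      uncut-in : ∀ b {x y} → x ∈ in′ → y ∈ in′ → uncut a (colour b) x y ≡ false
      uncut-in b {x} {y} x∈ y∈ with α x in αx | β x in βx | α y in αy | β y in βy
           | proj₂ (∈-filterᵇ⁻ s xs x∈) | proj₂ (∈-filterᵇ⁻ s xs y∈)
      ... | true  | _    | true  | _    | _ | _ rewrite α-indep αx αy = refl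
      ... | false | true | false | true | _ | _ rewrite β-indep βx βy = refl
      uncut-in true  {x} {y} x∈ y∈ | true  | _    | false | true | _ | _ = Bool.∧-zeroʳ (a x y)
      uncut-in false {x} {y} x∈ y∈ | true  | _    | false | true | _ | _ = Bool.∧-zeroʳ (a x y)
      uncut-in true  {x} {y} x∈ y∈ | false | true | true  | _    | _ | _ = Bool.∧-zeroʳ (a x y)
      uncut-in false {x} {y} x∈ y∈ | false | true | true  | _    | _ | _ = Bool.∧-zeroʳ (a x y)

      agrees-once : ∀ e b b′ → ⟦ e ∧ not (b xor b′) ⟧ + ⟦ e ∧ not (not b xor b′) ⟧ ≡ ⟦ e ⟧
      agrees-once false b     b′    = refl
      agrees-once true  true  true  = refl
      agrees-once true  true  false = refl
      agrees-once true  false true  = refl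
      agrees-once true  false false = refl

      -- Changing the Boolean reverses every colour in `in′` and none in `out`, so a crossing edge
      -- is monochromatic in exactly one of the two colourings.
      flipped : ∀ {x y} → x ∈ in′ → y ∈ out →
                ⟦ uncut a (colour true) x y ⟧ + ⟦ uncut a (colour false) x y ⟧ ≡ ⟦ a x y ⟧
      flipped {x} {y} x∈ y∈
        rewrite colour-out true y∈ | colour-out false y∈
        with α x | β x | proj₂ (∈-filterᵇ⁻ s xs x∈)
      ... | true  | _    | _ = agrees-once (a x y) true (c′ y)
      ... | false | true | _ = agrees-once (a x y) false (c′ y)

      crossing : Bool → ℕ
      crossing b = pairs (uncut a (colour b)) in′ out

      crossing-sum : crossing true + crossing false ≡ pairs a in′ out
      crossing-sum = trans (sym (∑-distrib-+ in′ _ _)) (∑-cong {xs = in′} λ x∈ →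
        trans (sym (∑-distrib-+ out _ _)) (∑-cong {xs = out} λ y∈ → flipped x∈ y∈))

      best : ∃[ b ] 2 * crossing b ≤ pairs a in′ out
      best with ≤-total (crossing true) (crossing false)
      ... | inj₁ le = true  , subst₂ _≤_ (n+n≡2*n (crossing true)) crossing-sum (+-monoʳ-≤ (crossing true) le)
      ... | inj₂ le = false , subst₂ _≤_ (n+n≡2*n (crossing false)) crossing-sum (+-monoˡ-≤ (crossing false) le)

    -- The better of the two placements of α and β opposite each other
    -- leaves at most half of the edges towards the rest uncut.
    peel : ∃[ c ] (cost xs c + (# out * # out + gain s xs) ≤ # xs * # xs + (cost out c′ + loss s xs))
    peel with best
    ... | b , le = colour b , (begin
      cost xs (colour b) + (# out * # out + gain s xs)
        ≡⟨ cong (_+ (# out * # out + gain s xs)) (cong₂ _+_ (cong (2 *_) (pairs-partition t t-sym s xs))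
            (cong (2 *_) (trans (pairs-partition (uncut a (colour b)) (uncut-sym a a-sym (colour b)) s xs)
              (cong₂ _+_ (cong (_+ 2 * crossing b) (pairs-zero {xs = in′} {ys = in′} (uncut-in b)))
                (pairs-cong {xs = out} {ys = out} λ {x} {y} x∈ y∈ →
                  cong₂ (λ p q → a x y ∧ not (p xor q)) (colour-out b x∈) (colour-out b y∈)))))) ⟩
      2 * (tii + 2 * tio + too) + 2 * (2 * crossing b + uoo) + (# out * # out + (# in′ * # in′ + 2 * nio))
        ≤⟨ +-monoˡ-≤ _ (+-monoʳ-≤ (2 * (tii + 2 * tio + too)) (*-monoʳ-≤ 2 (+-monoˡ-≤ uoo le))) ⟩
      2 * (tii + 2 * tio + too) + 2 * (aio + uoo) + (# out * # out + (# in′ * # in′ + 2 * nio))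
        ≡⟨ arith₁ tii tio too aio uoo nio (# in′) (# out) ⟩
      (# in′ * # in′ + # out * # out + 2 * (aio + nio)) + (2 * too + 2 * uoo + (2 * tii + 4 * tio))
        -- `aio` and `nio` together exhaust the pairs between `in′` and `out`, which supplies the
        -- mixed term of the square.
        ≡⟨ cong (λ k → (# in′ * # in′ + # out * # out + 2 * k) + (2 * too + 2 * uoo + (2 * tii + 4 * tio)))
             (sym (pairs-complement a in′ out)) ⟩
      (# in′ * # in′ + # out * # out + 2 * (# in′ * # out)) + (2 * too + 2 * uoo + (2 * tii + 4 * tio))
        ≡⟨ cong (_+ (2 * too + 2 * uoo + (2 * tii + 4 * tio))) (arith₂ (# in′) (# out)) ⟩
      (# in′ + # out) * (# in′ + # out) + (2 * too + 2 * uoo + (2 * tii + 4 * tio))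
        ≡⟨ cong (λ k → k * k + (2 * too + 2 * uoo + (2 * tii + 4 * tio))) (sym (length-partition s xs)) ⟩
      # xs * # xs + (cost out c′ + loss s xs) ∎)
      where
      open ≤-Reasoning
      tii = pairs t in′ in′
      tio = pairs t in′ out
      too = pairs t out out
      uoo = pairs (uncut a c′) out out
      aio = pairs a in′ out
      nio = pairs non in′ out
      arith₁ : ∀ tii tio too aio uoo nio i o →
        2 * (tii + 2 * tio + too) + 2 * (aio + uoo) + (o * o + (i * i + 2 * nio))
        ≡ (i * i + o * o + 2 * (aio + nio)) + (2 * too + 2 * uoo + (2 * tii + 4 * tio))
      arith₁ = solve-∀
      arith₂ : ∀ i o → i * i + o * o + 2 * (i * o) ≡ (i + o) * (i + o)
      arith₂ = solve-∀

    peel-≤ : cost out c′ ≤ # out * # out → loss s xs ≤ gain s xs → ∃[ c ] cost xs c ≤ # xs * # xs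
    peel-≤ cost≤ loss≤gain = let c , bound = peel in c ,
      +-cancelʳ-≤ (# out * # out + gain s xs) (cost xs c) (# xs * # xs)
        (≤-trans bound (+-monoʳ-≤ (# xs * # xs) (+-mono-≤ cost≤ loss≤gain)))

    -- The two comparisons are added up in the hypothesis so that strictness may come either from
    -- the colouring of the rest or from loss < gain.
    peel-< : cost out c′ + loss s xs < # out * # out + gain s xs → ∃[ c ] cost xs c < # xs * # xs
    peel-< lt = let c , bound = peel in c ,
      +-cancelʳ-< (# out * # out + gain s xs) (cost xs c) (# xs * # xs)
        (≤-<-trans bound (+-monoʳ-< (# xs * # xs) lt))

-- Multiple sums and AM-GM inequalities.

*-distribˡ-∑∑ : ∀ k (xs : List A) (ys : List B) (f : A → B → ℕ) →
  k * (∑[ x ← xs ] ∑[ y ← ys ] f x y) ≡ (∑[ x ← xs ] ∑[ y ← ys ] (k * f x y))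
*-distribˡ-∑∑ k xs ys f =
  trans (*-distribˡ-∑ k xs _) (∑-cong {xs = xs} λ _ → *-distribˡ-∑ k ys _)

∑-reverse : ∀ {C : Set} (xs : List A) (ys : List B) (zs : List C) (f : A → B → C → ℕ) →
  (∑[ x ← xs ] ∑[ y ← ys ] ∑[ z ← zs ] f x y z) ≡ (∑[ z ← zs ] ∑[ y ← ys ] ∑[ x ← xs ] f x y z)
∑-reverse xs ys zs f = begin
  (∑[ x ← xs ] ∑[ y ← ys ] ∑[ z ← zs ] f x y z) ≡⟨ ∑-cong {xs = xs} (λ _ → ∑-swap ys zs _) ⟩
  (∑[ x ← xs ] ∑[ z ← zs ] ∑[ y ← ys ] f x y z) ≡⟨ ∑-swap xs zs _ ⟩
  (∑[ z ← zs ] ∑[ x ← xs ] ∑[ y ← ys ] f x y z) ≡⟨ ∑-cong {xs = zs} (λ _ → ∑-swap xs ys _) ⟩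
  (∑[ z ← zs ] ∑[ y ← ys ] ∑[ x ← xs ] f x y z) ∎
  where open ≡-Reasoning

-- With o = m + k the two sides differ by k², which avoids subtraction.
m≤o⇒2mo≤m²+o² : ∀ {m o} → m ≤ o → 2 * (m * o) ≤ m * m + o * o
m≤o⇒2mo≤m²+o² {m} m≤o with m≤n⇒∃[o]m+o≡n m≤o
... | k , refl = m+n≤o⇒m≤o _ (≤-reflexive (arith m k))
  where arith : ∀ m k → 2 * (m * (m + k)) + k * k ≡ m * m + (m + k) * (m + k)
        arith = solve-∀

2mo≤m²+o² : ∀ m o → 2 * (m * o) ≤ m * m + o * o
2mo≤m²+o² m o with ≤-total m o
... | inj₁ m≤o = m≤o⇒2mo≤m²+o² m≤o
... | inj₂ o≤m = subst₂ _≤_ (cong (2 *_) (*-comm o m)) (+-comm (o * o) (m * m)) (m≤o⇒2mo≤m²+o² o≤m)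

4mo≤[m+o]² : ∀ m o → 4 * (m * o) ≤ (m + o) * (m + o)
4mo≤[m+o]² m o = subst₂ _≤_ (lhs m o) (rhs m o) (+-monoˡ-≤ (2 * (m * o)) (2mo≤m²+o² m o))
  where lhs : ∀ m o → 2 * (m * o) + 2 * (m * o) ≡ 4 * (m * o)
        lhs = solve-∀
        rhs : ∀ m o → m * m + o * o + 2 * (m * o) ≡ (m + o) * (m + o)
        rhs = solve-∀

2e≤pq+p′q′ : ∀ {e p q p′ q′} → e ≤ p′ * p → p ≤ q → p′ ≤ q′ → 2 * e ≤ p * q + p′ * q′
2e≤pq+p′q′ {e} {p} {q} {p′} {q′} e≤ p≤q p′≤q′ = begin
  2 * e             ≤⟨ *-monoʳ-≤ 2 e≤ ⟩
  2 * (p′ * p)      ≡⟨ cong (2 *_) (*-comm p′ p) ⟩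
  2 * (p * p′)      ≤⟨ 2mo≤m²+o² p p′ ⟩
  p * p + p′ * p′   ≤⟨ +-mono-≤ (*-monoʳ-≤ p p≤q) (*-monoʳ-≤ p′ p′≤q′) ⟩
  p * q + p′ * q′   ∎
  where open ≤-Reasoning

-- One of two estimates becomes strict. If p′ < q′, enlarging p′² to p′q′ is strict because p′ > 0;
-- if p′ = q′, the last hypothesis reads e < p′p.
2e<pq+p′q′ : ∀ {e p q p′ q′} → e ≤ p′ * p → p ≤ q → p′ ≤ q′ → 0 < p′ → e < q′ * p →
             2 * e < p * q + p′ * q′
2e<pq+p′q′ {e} {p} {q} {p′} {q′} e≤ p≤q p′≤q′ 0<p′ e< with m≤n⇒m<n∨m≡n p′≤q′
... | inj₁ p′<q′ = begin-strict
  2 * e             ≤⟨ *-monoʳ-≤ 2 e≤ ⟩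
  2 * (p′ * p)      ≡⟨ cong (2 *_) (*-comm p′ p) ⟩
  2 * (p * p′)      ≤⟨ 2mo≤m²+o² p p′ ⟩
  p * p + p′ * p′   <⟨ +-mono-≤-< (*-monoʳ-≤ p p≤q) (*-monoʳ-< p′ {{>-nonZero 0<p′}} p′<q′) ⟩
  p * q + p′ * q′   ∎
  where open ≤-Reasoning
... | inj₂ refl = begin-strict
  2 * e             <⟨ *-monoʳ-< 2 e< ⟩
  2 * (p′ * p)      ≡⟨ cong (2 *_) (*-comm p′ p) ⟩
  2 * (p * p′)      ≤⟨ 2mo≤m²+o² p p′ ⟩
  p * p + p′ * p′   ≤⟨ +-monoˡ-≤ (p′ * p′) (*-monoʳ-≤ p p≤q) ⟩
  p * q + p′ * q′   ∎
  where open ≤-Reasoning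

-- Averaging gain and loss over the edges of T.

module Average {V : Set} (a t : V → V → Bool)
  (a-sym : ∀ x y → a x y ≡ a y x) (t-sym : ∀ x y → t x y ≡ t y x)
  (t⇒a : ∀ {x y} → t x y ≡ true → a x y ≡ true)
  (t-walk : ∀ {x y z} → t x y ≡ true → t y z ≡ true → a x z ≡ false)
  (xs : List V) where

  open Peel a t a-sym t-sym

  d : V → ℕ
  d v = ∑[ x ← xs ] ⟦ t v x ⟧

  p q e : V → V → ℕ
  p u w = ∑[ y ← xs ] (⟦ t u y ⟧ * ⟦ non y w ⟧)
  q u w = ∑[ y ← xs ] (⟦ t u y ⟧ * ⟦ not (t w y) ⟧)
  e u w = ∑[ x ← xs ] ∑[ v ← xs ] (⟦ t u v ⟧ * (⟦ t v x ⟧ * ⟦ t x w ⟧))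

  p≤q : ∀ u w → p u w ≤ q u w
  p≤q u w = ∑-mono-≤ {xs = xs} λ {y} _ → *-monoʳ-≤ ⟦ t u y ⟧ (le y)
    where
    le : ∀ y → ⟦ non y w ⟧ ≤ ⟦ not (t w y) ⟧
    le y with t w y in eq
    ... | true rewrite t⇒a (trans (t-sym y w) eq) = z≤n
    ... | false with a y w
    ...   | true  = z≤n
    ...   | false = ≤-refl

  -- On a T-walk u v x w, the pairs v, w and x, u have common T-neighbours.
  e≤p′p : ∀ u w → e u w ≤ p w u * p u w
  e≤p′p u w = subst (e u w ≤_) (sym (∑-product xs xs _ _))
    (∑-mono-≤ {xs = xs} λ {x} _ → ∑-mono-≤ {xs = xs} λ {v} _ → le x v)
    where
    le : ∀ x v → ⟦ t u v ⟧ * (⟦ t v x ⟧ * ⟦ t x w ⟧) ≤ (⟦ t w x ⟧ * ⟦ non x u ⟧) * (⟦ t u v ⟧ * ⟦ non v w ⟧)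
    le x v with t u v in uv | t v x in vx | t x w in xw
    ... | false | _     | _     = z≤n
    ... | true  | false | _     = z≤n
    ... | true  | true  | false = z≤n
    ... | true  | true  | true
      rewrite trans (t-sym w x) xw | trans (a-sym x u) (t-walk uv vx) | t-walk vx xw = ≤-refl

  -- A T-walk u v x w yields x in N(w) outside N(u) and v in N(u) not adjacent to w, a pair counted
  -- on the right. The pair formed by the given `w′` and `v` is counted there too but lies on no
  -- such walk, as v w′ is not in T.
  e<q′p : ∀ {u w v w′} → v ∈ xs → w′ ∈ xs → t u v ≡ true → a v w ≡ false →
          t w w′ ≡ true → t u w′ ≡ false → t v w′ ≡ false → e u w < q w u * p u w
  e<q′p {u} {w} {v} {w′} v∈ w′∈ uv vw ww′ uw′ vw′ = subst (e u w <_) (sym (∑-product xs xs _ _))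
    (∑-mono-< {xs = xs} (λ {x} _ → ∑-mono-≤ {xs = xs} λ {v} _ → le x v) w′∈
      (∑-mono-< {xs = xs} (λ {v} _ → le w′ v) v∈ lt))
    where
    le : ∀ x v → ⟦ t u v ⟧ * (⟦ t v x ⟧ * ⟦ t x w ⟧) ≤ (⟦ t w x ⟧ * ⟦ not (t u x) ⟧) * (⟦ t u v ⟧ * ⟦ non v w ⟧)
    le x v with t u v in uv | t v x in vx | t x w in xw
    ... | false | _     | _     = z≤n
    ... | true  | false | _     = z≤n
    ... | true  | true  | false = z≤n
    ... | true  | true  | true with t u x in ux
    ...   | true  = contradiction (trans (sym (t-walk uv vx)) (t⇒a ux)) λ ()
    ...   | false rewrite trans (t-sym w x) xw | t-walk vx xw = ≤-refl
    lt : ⟦ t u v ⟧ * (⟦ t v w′ ⟧ * ⟦ t w′ w ⟧) < (⟦ t w w′ ⟧ * ⟦ not (t u w′) ⟧) * (⟦ t u v ⟧ * ⟦ non v w ⟧)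
    lt rewrite uv | vw | ww′ | uw′ | vw′ = ≤-refl

  -- Every edge of T occurs in both directions, so the roles of its ends can be exchanged under the
  -- sum.
  ∑edges : (V → V → ℕ) → ℕ
  ∑edges f = ∑[ u ← xs ] ∑[ v ← xs ] (⟦ t u v ⟧ * f u v)

  ∑edges-flip : ∀ f → ∑edges f ≡ ∑edges (flip f)
  ∑edges-flip f = trans (∑-swap xs xs _) (∑-cong {xs = xs} λ {v} _ → ∑-cong {xs = xs} λ {u} _ →
    cong (λ b → ⟦ b ⟧ * f u v) (t-sym u v))

  ∑edges-cong : ∀ {f g} → (∀ {u v} → t u v ≡ true → f u v ≡ g u v) → ∑edges f ≡ ∑edges g
  ∑edges-cong {f} {g} eq = ∑-cong {xs = xs} λ {u} _ → ∑-cong {xs = xs} λ {v} _ → on u v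
    where
    on : ∀ u v → ⟦ t u v ⟧ * f u v ≡ ⟦ t u v ⟧ * g u v
    on u v with t u v in uv
    ... | true  = cong (_+ 0) (eq uv)
    ... | false = refl

  ∑edges-+ : ∀ f g → ∑edges (λ u v → f u v + g u v) ≡ ∑edges f + ∑edges g
  ∑edges-+ f g = trans
    (∑-cong {xs = xs} λ {u} _ → trans (∑-cong {xs = xs} λ {v} _ → *-distribˡ-+ ⟦ t u v ⟧ _ _) (∑-distrib-+ xs _ _))
    (∑-distrib-+ xs _ _)

  ∑edges-* : ∀ k f → ∑edges (λ u v → k * f u v) ≡ k * ∑edges f
  ∑edges-* k f = sym (trans (*-distribˡ-∑∑ k xs xs _)
    (∑-cong {xs = xs} λ {u} _ → ∑-cong {xs = xs} λ {v} _ → arith k ⟦ t u v ⟧ (f u v)))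
    where arith : ∀ k b m → k * (b * m) ≡ b * (k * m)
          arith = solve-∀

  ∑edges-mono : ∀ {f g} → (∀ u v → f u v ≤ g u v) → ∑edges f ≤ ∑edges g
  ∑edges-mono le = ∑-mono-≤ {xs = xs} λ {u} _ → ∑-mono-≤ {xs = xs} λ {v} _ → *-monoʳ-≤ ⟦ t u v ⟧ (le u v)

  -- For z = u or z = v: the part of the r-pairs leaving N(u) ∪ N(v) that starts in N(z).
  leaving : (V → V → Bool) → V → V → V → ℕ
  leaving r z u v = ∑[ x ← xs ] ∑[ w ← xs ] (⟦ t z x ⟧ * ((⟦ not (t u w) ⟧ * ⟦ not (t v w) ⟧) * ⟦ r x w ⟧))

  -- A common T-neighbour would make u and v non-adjacent by `t-walk`.
  nbrs-disjoint : ∀ {u v} → t u v ≡ true → ∀ x → ⟦ nbrs u v x ⟧ ≡ ⟦ t u x ⟧ + ⟦ t v x ⟧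
  nbrs-disjoint {u} {v} uv x with t u x in ux | t v x in vx
  ... | true  | true  = contradiction (trans (sym (t⇒a uv)) (t-walk ux (trans (t-sym x v) vx))) λ ()
  ... | true  | false = refl
  ... | false | true  = refl
  ... | false | false = refl

  ⟦not-∨⟧ : ∀ b c → ⟦ not (b ∨ c) ⟧ ≡ ⟦ not b ⟧ * ⟦ not c ⟧
  ⟦not-∨⟧ true  c = refl
  ⟦not-∨⟧ false c = sym (+-identityʳ _)

  ∑-nbrs : ∀ {u v} → t u v ≡ true → ∀ f →
    ∑ (filterᵇ (nbrs u v) xs) f ≡ (∑[ x ← xs ] (⟦ t u x ⟧ * f x)) + (∑[ x ← xs ] (⟦ t v x ⟧ * f x))
  ∑-nbrs {u} {v} uv f = trans (∑-filterᵇ (nbrs u v) xs f) (trans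
    (∑-cong {xs = xs} λ {x} _ → trans (cong (_* f x) (nbrs-disjoint uv x)) (*-distribʳ-+ (f x) ⟦ t u x ⟧ ⟦ t v x ⟧))
    (∑-distrib-+ xs _ _))

  pairs-leaving : ∀ r {u v} → t u v ≡ true →
    pairs r (filterᵇ (nbrs u v) xs) (rest (nbrs u v) xs) ≡ leaving r u u v + leaving r v u v
  pairs-leaving r {u} {v} uv = trans (∑-nbrs uv _) (cong₂ _+_ (side u) (side v))
    where
    side : ∀ z → (∑[ x ← xs ] (⟦ t z x ⟧ * (∑[ w ← rest (nbrs u v) xs ] ⟦ r x w ⟧))) ≡ leaving r z u v
    side z = ∑-cong {xs = xs} λ {x} _ → trans
      (cong (⟦ t z x ⟧ *_) (trans (∑-filterᵇ (not ∘ nbrs u v) xs _)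
        (∑-cong {xs = xs} λ {w} _ → cong (_* ⟦ r x w ⟧) (⟦not-∨⟧ (t u w) (t v w)))))
      (*-distribˡ-∑ ⟦ t z x ⟧ xs _)

  leaving-flip : ∀ r → ∑edges (λ u v → leaving r u u v) ≡ ∑edges (λ u v → leaving r v u v)
  leaving-flip r = trans (∑edges-flip _) (∑edges-cong λ {u} {v} _ →
    ∑-cong {xs = xs} λ {x} _ → ∑-cong {xs = xs} λ {w} _ →
    cong (λ k → ⟦ t v x ⟧ * (k * ⟦ r x w ⟧)) (*-comm ⟦ not (t v w) ⟧ ⟦ not (t u w) ⟧))

  size-nbrs : ∀ {u v} → t u v ≡ true → # filterᵇ (nbrs u v) xs ≡ d u + d v
  size-nbrs {u} {v} uv = trans (sym (∑-one (filterᵇ (nbrs u v) xs))) (trans (∑-nbrs uv _)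
    (cong₂ _+_ (∑-cong {xs = xs} λ _ → *-identityʳ _) (∑-cong {xs = xs} λ _ → *-identityʳ _)))

  -- The number of T-walks with two edges that start at `u`.
  D : V → ℕ
  D u = ∑[ x ← xs ] (⟦ t u x ⟧ * d x)

  gain-nbrs : ∀ {u v} → t u v ≡ true → gain (nbrs u v) xs ≡
    (d u + d v) * (d u + d v) + 2 * (leaving non u u v + leaving non v u v)
  gain-nbrs uv = cong₂ _+_ (cong₂ _*_ (size-nbrs uv) (size-nbrs uv)) (cong (2 *_) (pairs-leaving non uv))

  -- Half of the crossing term completes the inner pairs to the sum of the T-degrees over N(u) and
  -- N(v), which is D(u) + D(v).
  loss-nbrs : ∀ {u v} → t u v ≡ true → loss (nbrs u v) xs ≡
    2 * (D u + D v) + 2 * (leaving t u u v + leaving t v u v)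
  loss-nbrs {u} {v} uv = begin
    2 * tii + 4 * tio                ≡⟨ arith tii tio ⟩
    2 * (tii + tio) + 2 * tio        ≡⟨ cong₂ (λ k l → 2 * k + 2 * l) degrees (pairs-leaving t uv) ⟩
    2 * (D u + D v) + 2 * (leaving t u u v + leaving t v u v) ∎
    where
    open ≡-Reasoning
    in′ = filterᵇ (nbrs u v) xs
    tii = pairs t in′ in′
    tio = pairs t in′ (rest (nbrs u v) xs)
    arith : ∀ m n → 2 * m + 4 * n ≡ 2 * (m + n) + 2 * n
    arith = solve-∀
    degrees : tii + tio ≡ D u + D v
    degrees = trans (sym (∑-distrib-+ in′ _ _)) (trans
      (∑-cong {xs = in′} λ _ → sym (∑-partition (nbrs u v) xs _)) (∑-nbrs uv d))

  -- The diagonal u = w is included.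
  ∑nonedges : (V → V → ℕ) → ℕ
  ∑nonedges f = ∑[ u ← xs ] ∑[ w ← xs ] (⟦ not (t u w) ⟧ * f u w)

  -- Double counting of quadruples u, v, x, w. Once u and w are fixed, the choices of x and v are
  -- independent: x ranges over the members of N(u) not adjacent to w, and v over N(u) outside N(w).
  ∑edges-non : ∑edges (λ u v → leaving non u u v) ≡ ∑nonedges (λ u w → p u w * q u w)
  ∑edges-non = ∑-cong {xs = xs} λ {u} _ → begin
    (∑[ v ← xs ] (⟦ t u v ⟧ * leaving non u u v))
      ≡⟨ ∑-cong {xs = xs} (λ {v} _ → *-distribˡ-∑∑ ⟦ t u v ⟧ xs xs _) ⟩
    (∑[ v ← xs ] ∑[ x ← xs ] ∑[ w ← xs ] (⟦ t u v ⟧ * (⟦ t u x ⟧ * ((⟦ not (t u w) ⟧ * ⟦ not (t v w) ⟧) * ⟦ non x w ⟧))))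
      ≡⟨ ∑-reverse xs xs xs _ ⟩
    (∑[ w ← xs ] ∑[ x ← xs ] ∑[ v ← xs ] (⟦ t u v ⟧ * (⟦ t u x ⟧ * ((⟦ not (t u w) ⟧ * ⟦ not (t v w) ⟧) * ⟦ non x w ⟧))))
      ≡⟨ ∑-cong {xs = xs} (λ {w} _ → ∑-cong {xs = xs} λ {x} _ → ∑-cong {xs = xs} λ {v} _ →
           trans (cong (λ b → ⟦ t u v ⟧ * (⟦ t u x ⟧ * ((⟦ not (t u w) ⟧ * ⟦ not b ⟧) * ⟦ non x w ⟧))) (t-sym v w))
             (arith ⟦ t u v ⟧ ⟦ t u x ⟧ ⟦ not (t u w) ⟧ ⟦ not (t w v) ⟧ ⟦ non x w ⟧)) ⟩
    (∑[ w ← xs ] ∑[ x ← xs ] ∑[ v ← xs ] (⟦ not (t u w) ⟧ * ((⟦ t u x ⟧ * ⟦ non x w ⟧) * (⟦ t u v ⟧ * ⟦ not (t w v) ⟧))))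
      ≡⟨ ∑-cong {xs = xs} (λ {w} _ → trans (sym (*-distribˡ-∑∑ ⟦ not (t u w) ⟧ xs xs _))
           (cong (⟦ not (t u w) ⟧ *_) (sym (∑-product xs xs _ _)))) ⟩
    (∑[ w ← xs ] (⟦ not (t u w) ⟧ * (p u w * q u w))) ∎
    where
    open ≡-Reasoning
    arith : ∀ b c d e f → b * (c * ((d * e) * f)) ≡ d * ((c * f) * (b * e))
    arith = solve-∀

  -- The left side counts T-walks u v x w with w outside N(u) and N(v). Forgetting that w is outside
  -- N(v) leaves the walks counted by `e`.
  ∑edges-t : ∑edges (λ u v → leaving t v u v) ≤ ∑nonedges e
  ∑edges-t = ∑-mono-≤ {xs = xs} λ {u} _ → begin
    (∑[ v ← xs ] (⟦ t u v ⟧ * leaving t v u v))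
      ≡⟨ ∑-cong {xs = xs} (λ {v} _ → *-distribˡ-∑∑ ⟦ t u v ⟧ xs xs _) ⟩
    (∑[ v ← xs ] ∑[ x ← xs ] ∑[ w ← xs ] (⟦ t u v ⟧ * (⟦ t v x ⟧ * ((⟦ not (t u w) ⟧ * ⟦ not (t v w) ⟧) * ⟦ t x w ⟧))))
      ≡⟨ ∑-reverse xs xs xs _ ⟩
    (∑[ w ← xs ] ∑[ x ← xs ] ∑[ v ← xs ] (⟦ t u v ⟧ * (⟦ t v x ⟧ * ((⟦ not (t u w) ⟧ * ⟦ not (t v w) ⟧) * ⟦ t x w ⟧))))
      ≤⟨ ∑-mono-≤ {xs = xs} (λ {w} _ → ∑-mono-≤ {xs = xs} λ {x} _ → ∑-mono-≤ {xs = xs} λ {v} _ →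
           drop ⟦ t u v ⟧ ⟦ t v x ⟧ ⟦ not (t u w) ⟧ (t v w) ⟦ t x w ⟧) ⟩
    (∑[ w ← xs ] ∑[ x ← xs ] ∑[ v ← xs ] (⟦ not (t u w) ⟧ * (⟦ t u v ⟧ * (⟦ t v x ⟧ * ⟦ t x w ⟧))))
      ≡⟨ ∑-cong {xs = xs} (λ {w} _ → sym (*-distribˡ-∑∑ ⟦ not (t u w) ⟧ xs xs _)) ⟩
    (∑[ w ← xs ] (⟦ not (t u w) ⟧ * e u w)) ∎
    where
    open ≤-Reasoning
    arith : ∀ b c d f → b * (c * ((d * 1) * f)) ≡ d * (b * (c * f))
    arith = solve-∀
    drop : ∀ b c d e f → b * (c * ((d * ⟦ not e ⟧) * f)) ≤ d * (b * (c * f))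
    drop b c d false f = ≤-reflexive (arith b c d f)
    drop b c d true  f rewrite *-zeroʳ d | *-zeroʳ c | *-zeroʳ b = z≤n

  totalGain totalLoss : ℕ
  totalGain = ∑edges (λ u v → gain (nbrs u v) xs)
  totalLoss = ∑edges (λ u v → loss (nbrs u v) xs)

  -- Both sides count T-walks with three edges, the left one grown from an end edge and the right
  -- one from the middle edge.
  ∑edges-D : ∑edges (λ u v → D u) ≡ ∑edges (λ u v → d u * d v)
  ∑edges-D = ∑-cong {xs = xs} λ {u} _ → begin
    (∑[ v ← xs ] (⟦ t u v ⟧ * D u)) ≡⟨ *-distribʳ-∑ (D u) xs _ ⟨
    d u * D u                       ≡⟨ *-distribˡ-∑ (d u) xs _ ⟩
    (∑[ v ← xs ] (d u * (⟦ t u v ⟧ * d v)))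
      ≡⟨ ∑-cong {xs = xs} (λ {v} _ → arith (d u) ⟦ t u v ⟧ (d v)) ⟩
    (∑[ v ← xs ] (⟦ t u v ⟧ * (d u * d v))) ∎
    where
    open ≡-Reasoning
    arith : ∀ k b m → k * (b * m) ≡ b * (k * m)
    arith = solve-∀

  ∑edges-degrees : ∑edges (λ u v → 2 * (D u + D v)) ≤ ∑edges (λ u v → (d u + d v) * (d u + d v))
  ∑edges-degrees = begin
    ∑edges (λ u v → 2 * (D u + D v))   ≡⟨ ∑edges-* 2 _ ⟩
    2 * ∑edges (λ u v → D u + D v)     ≡⟨ cong (2 *_) (∑edges-+ _ _) ⟩
    2 * (∑edges (λ u v → D u) + ∑edges (λ u v → D v))
      ≡⟨ cong₂ (λ k l → 2 * (k + l)) ∑edges-D (trans (∑edges-flip _) ∑edges-D) ⟩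
    2 * (s + s)                        ≡⟨ arith s ⟩
    4 * s                              ≡⟨ ∑edges-* 4 _ ⟨
    ∑edges (λ u v → 4 * (d u * d v))   ≤⟨ ∑edges-mono (λ u v → 4mo≤[m+o]² (d u) (d v)) ⟩
    ∑edges (λ u v → (d u + d v) * (d u + d v)) ∎
    where
    open ≤-Reasoning
    s = ∑edges (λ u v → d u * d v)
    arith : ∀ s → 2 * (s + s) ≡ 4 * s
    arith = solve-∀

  -- In subtractive form, total loss minus total gain is at most 4 times the sum of e - pq over the
  -- pairs not in T. The degree terms are absorbed by `∑edges-degrees`. The 4 is the factor 2 in
  -- `gain-nbrs` and `loss-nbrs`, doubled because the parts leaving N(u) and N(v) have equal sums.
  balance : totalLoss + 4 * ∑nonedges (λ u w → p u w * q u w) ≤ totalGain + 4 * ∑nonedges e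
  balance = begin
    totalLoss + 4 * N                   ≡⟨ cong (_+ 4 * N) (∑edges-cong loss-nbrs) ⟩
    ∑edges (λ u v → 2 * (D u + D v) + 2 * (leaving t u u v + leaving t v u v)) + 4 * N
      ≡⟨ cong (_+ 4 * N) (trans (∑edges-+ _ _) (cong (L +_) (doubled t))) ⟩
    L + 4 * ∑edges (λ u v → leaving t v u v) + 4 * N
      ≤⟨ +-monoˡ-≤ (4 * N) (+-mono-≤ ∑edges-degrees (*-monoʳ-≤ 4 ∑edges-t)) ⟩
    S + 4 * ∑nonedges e + 4 * N         ≡⟨ arith S (4 * ∑nonedges e) (4 * N) ⟩
    S + 4 * N + 4 * ∑nonedges e
      ≡⟨ cong (λ k → S + k + 4 * ∑nonedges e) (trans (doubled non) (cong (4 *_) (trans (sym (leaving-flip non)) ∑edges-non))) ⟨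
    S + ∑edges (λ u v → 2 * (leaving non u u v + leaving non v u v)) + 4 * ∑nonedges e
      ≡⟨ cong (_+ 4 * ∑nonedges e) (trans (∑edges-cong gain-nbrs) (∑edges-+ _ _)) ⟨
    totalGain + 4 * ∑nonedges e ∎
    where
    open ≤-Reasoning
    N = ∑nonedges (λ u w → p u w * q u w)
    L = ∑edges (λ u v → 2 * (D u + D v))
    S = ∑edges (λ u v → (d u + d v) * (d u + d v))
    arith : ∀ a b c → a + b + c ≡ a + c + b
    arith = solve-∀
    arith₂ : ∀ s → 2 * (s + s) ≡ 4 * s
    arith₂ = solve-∀
    doubled : ∀ r → ∑edges (λ u v → 2 * (leaving r u u v + leaving r v u v)) ≡ 4 * ∑edges (λ u v → leaving r v u v)
    doubled r = trans (∑edges-* 2 _) (trans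
      (cong (2 *_) (trans (∑edges-+ _ _) (cong (_+ ∑edges (λ u v → leaving r v u v)) (leaving-flip r))))
      (arith₂ (∑edges (λ u v → leaving r v u v))))

  ∑nonedges-pq+p′q′ : ∑nonedges (λ u w → p u w * q u w + p w u * q w u) ≡ 2 * ∑nonedges (λ u w → p u w * q u w)
  ∑nonedges-pq+p′q′ = begin
    ∑nonedges (λ u w → p u w * q u w + p w u * q w u)
      ≡⟨ ∑-cong {xs = xs} (λ {u} _ → trans (∑-cong {xs = xs} λ {w} _ → *-distribˡ-+ ⟦ not (t u w) ⟧ _ _) (∑-distrib-+ xs _ _)) ⟩
    (∑[ u ← xs ] ((∑[ w ← xs ] (⟦ not (t u w) ⟧ * (p u w * q u w))) + (∑[ w ← xs ] (⟦ not (t u w) ⟧ * (p w u * q w u)))))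
      ≡⟨ ∑-distrib-+ xs _ _ ⟩
    N + ∑nonedges (λ u w → p w u * q w u)
      ≡⟨ cong (N +_) (trans (∑-swap xs xs _) (∑-cong {xs = xs} λ {w} _ → ∑-cong {xs = xs} λ {u} _ →
           cong (λ b → ⟦ not b ⟧ * (p w u * q w u)) (t-sym u w))) ⟩
    N + N  ≡⟨ cong (N +_) (+-identityʳ N) ⟨
    2 * N  ∎
    where
    open ≡-Reasoning
    N = ∑nonedges (λ u w → p u w * q u w)

  2∑e : 2 * ∑nonedges e ≡ ∑nonedges (λ u w → 2 * e u w)
  2∑e = trans (*-distribˡ-∑∑ 2 xs xs _) (∑-cong {xs = xs} λ {u} _ → ∑-cong {xs = xs} λ {w} _ → arith ⟦ not (t u w) ⟧ (e u w))
    where arith : ∀ b m → 2 * (b * m) ≡ b * (2 * m)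
          arith = solve-∀

  walks≤ : ∀ u w → 2 * e u w ≤ p u w * q u w + p w u * q w u
  walks≤ u w = 2e≤pq+p′q′ (e≤p′p u w) (p≤q u w) (p≤q w u)

  totalLoss≤totalGain : totalLoss ≤ totalGain
  totalLoss≤totalGain = +-cancelʳ-≤ (4 * ∑nonedges e) totalLoss totalGain
    (≤-trans (+-monoʳ-≤ totalLoss (*-monoʳ-≤ 4 H≤N)) balance)
    where
    H≤N : ∑nonedges e ≤ ∑nonedges (λ u w → p u w * q u w)
    H≤N = *-cancelˡ-≤ 2 (subst₂ _≤_ (sym 2∑e) ∑nonedges-pq+p′q′
      (∑-mono-≤ {xs = xs} λ {u} _ → ∑-mono-≤ {xs = xs} λ {w} _ → *-monoʳ-≤ ⟦ not (t u w) ⟧ (walks≤ u w)))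

  -- Strictness at the single pair u, w suffices, all other pairs obeying the weak inequality. There
  -- `x` witnesses that p(w,u) is positive, and `w′` with `v` supplies the pair missed in `e<q′p`.
  totalLoss<totalGain : ∀ {u v x w w′} → u ∈ xs → v ∈ xs → x ∈ xs → w ∈ xs → w′ ∈ xs →
    t u v ≡ true → t v x ≡ true → t x w ≡ true → t w w′ ≡ true →
    t u w ≡ false → t u w′ ≡ false → t v w′ ≡ false → totalLoss < totalGain
  totalLoss<totalGain {u} {v} {x} {w} {w′} u∈ v∈ x∈ w∈ w′∈ uv vx xw ww′ uw uw′ vw′ =
    +-cancelʳ-< (4 * ∑nonedges e) totalLoss totalGain
      (≤-trans (+-monoʳ-< totalLoss (*-monoʳ-< 4 H<N)) balance)
    where
    at : 2 * e u w < p u w * q u w + p w u * q w u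
    at = 2e<pq+p′q′ (e≤p′p u w) (p≤q u w) (p≤q w u)
      (subst (_< p w u) (∑-zero xs) (∑-mono-< {xs = xs} (λ _ → z≤n) x∈ 0<))
      (e<q′p v∈ w′∈ uv (t-walk vx xw) ww′ uw′ vw′)
      where
      0< : 0 < ⟦ t w x ⟧ * ⟦ non x u ⟧
      0< rewrite trans (t-sym w x) xw | trans (a-sym x u) (t-walk uv vx) = ≤-refl
    le : ∀ u w → ⟦ not (t u w) ⟧ * (2 * e u w) ≤ ⟦ not (t u w) ⟧ * (p u w * q u w + p w u * q w u)
    le u w = *-monoʳ-≤ ⟦ not (t u w) ⟧ (walks≤ u w)
    lt : ⟦ not (t u w) ⟧ * (2 * e u w) < ⟦ not (t u w) ⟧ * (p u w * q u w + p w u * q w u)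
    lt rewrite uw = *-monoʳ-< 1 at
    H<N : ∑nonedges e < ∑nonedges (λ u w → p u w * q u w)
    H<N = *-cancelˡ-< 2 _ _ (subst₂ _<_ (sym 2∑e) ∑nonedges-pq+p′q′
      (∑-mono-< {xs = xs} (λ {u} _ → ∑-mono-≤ {xs = xs} λ {w} _ → le u w) u∈
        (∑-mono-< {xs = xs} (λ {w} _ → le u w) w∈ lt)))

-- Finite search and the equality case of AM-GM.

lookup-injective : ∀ {A : Set} {xs : List A} → Unique xs → ∀ {i j} → lookup xs i ≡ lookup xs j → i ≡ j
lookup-injective {xs = x ∷ xs} (x∉ ∷ u) {zero}  {zero}  eq = refl
lookup-injective {xs = x ∷ xs} (x∉ ∷ u) {zero}  {suc j} eq = contradiction eq (All.lookup x∉ (∈-lookup j))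
lookup-injective {xs = x ∷ xs} (x∉ ∷ u) {suc i} {zero}  eq = contradiction (sym eq) (All.lookup x∉ (∈-lookup i))
lookup-injective {xs = x ∷ xs} (x∉ ∷ u) {suc i} {suc j} eq = cong suc (lookup-injective u eq)

search : ∀ {A : Set} {P : A → Set} → Decidable P → ∀ xs →
         (∃[ x ] x ∈ xs × P x) ⊎ (∀ {x} → x ∈ xs → ¬ P x)
search P? xs with Any.any? P? xs
... | yes some = inj₁ (find some)
... | no none  = inj₂ λ x∈ Px → none (lose x∈ Px)

search₂ : ∀ {A : Set} {P : A → A → Set} → (∀ x y → Dec (P x y)) → ∀ xs →
          (∃[ x ] ∃[ y ] x ∈ xs × y ∈ xs × P x y) ⊎ (∀ {x y} → x ∈ xs → y ∈ xs → ¬ P x y)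
search₂ P? xs with search (λ x → Any.any? (P? x) xs) xs
... | inj₁ (x , x∈ , some) = let y , y∈ , Pxy = find some in inj₁ (x , y , x∈ , y∈ , Pxy)
... | inj₂ none            = inj₂ λ x∈ y∈ Pxy → none x∈ (lose y∈ Pxy)

∈⇒0<length : ∀ {A : Set} {xs : List A} {x} → x ∈ xs → 0 < length xs
∈⇒0<length (here _)  = s≤s z≤n
∈⇒0<length (there _) = s≤s z≤n

∑≡0⇒≡0 : ∀ {A : Set} {xs : List A} {f : A → ℕ} → ∑ xs f ≡ 0 → ∀ {x} → x ∈ xs → f x ≡ 0
∑≡0⇒≡0 {f = f} eq (here {x = y} refl) = m+n≡0⇒m≡0 (f y) eq
∑≡0⇒≡0 {f = f} eq (there {x = y} x∈)  = ∑≡0⇒≡0 (m+n≡0⇒n≡0 (f y) eq) x∈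

⟦⟧≡0 : ∀ {b} → ⟦ b ⟧ ≡ 0 → b ≡ false
⟦⟧≡0 {false} _ = refl

-- With o = m + 1 + k the two sides differ by (k + 1)².
4mo<[m+o]² : ∀ {m o} → m < o → 4 * (m * o) < (m + o) * (m + o)
4mo<[m+o]² {m} m<o with m≤n⇒∃[o]m+o≡n m<o
... | k , refl = m+n≤o⇒m≤o _ (≤-reflexive (arith m k))
  where arith : ∀ m k → suc (4 * (m * (suc m + k))) + (2 * k + k * k) ≡ (m + (suc m + k)) * (m + (suc m + k))
        arith = solve-∀

[m+o]²≤4mo⇒m≡o : ∀ m o → (m + o) * (m + o) ≤ 4 * (m * o) → m ≡ o
[m+o]²≤4mo⇒m≡o m o le with <-cmp m o
... | tri< m<o _ _ = contradiction le (<⇒≱ (4mo<[m+o]² m<o))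
... | tri≈ _ eq _ = eq
... | tri> _ _ o<m = contradiction le (<⇒≱
  (subst₂ _<_ (cong (4 *_) (*-comm o m)) (cong (λ k → k * k) (+-comm o m)) (4mo<[m+o]² o<m)))

-- Induction on the remaining vertices.

module Induct {V : Set} (_≟_ : DecidableEquality V) (a t : V → V → Bool)
  (a-sym : ∀ x y → a x y ≡ a y x) (t-sym : ∀ x y → t x y ≡ t y x)
  (a-irrefl : ∀ x → a x x ≡ false)
  (t⇒a : ∀ {x y} → t x y ≡ true → a x y ≡ true)
  (t-walk : ∀ {x y z} → t x y ≡ true → t y z ≡ true → a x z ≡ false) where

  open Peel a t a-sym t-sym
  open Average a t a-sym t-sym t⇒a t-walk

  t-sym-true : ∀ {x y} → t x y ≡ true → t y x ≡ true
  t-sym-true {x} {y} = trans (t-sym y x)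

  common-nbr : ∀ {u x y} → t u x ≡ true → t u y ≡ true → a x y ≡ false
  common-nbr ux uy = t-walk (t-sym-true ux) uy

  -- A join of balanced complete bipartite graphs on the vertices of `xs`, given by an enumeration
  -- rather than an isomorphism so that the induction can prepend a block. Distinct blocks are kept
  -- disjoint by `outer`, since no vertex is adjacent to itself.
  record Blocks (xs : List V) : Set where
    field
      k        : ℕ
      size     : Fin k → ℕ
      positive : ∀ i → 1 ≤ size i
      at       : ∀ i → Fin (size i) ⊎ Fin (size i) → V
      at-∈     : ∀ i p → at i p ∈ xs
      at-onto  : ∀ {x} → x ∈ xs → ∃[ i ] ∃[ p ] at i p ≡ x
      at-injective : ∀ i {p q} → at i p ≡ at i q → p ≡ q
      inner   : ∀ i p q → a (at i p) (at i q) ≡ does (adj? (K (size i) (size i)) p q)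
      outer   : ∀ {i j} → i ≢ j → ∀ p q → a (at i p) (at j q) ≡ true

  -- Carried through the induction because the equality argument has to extend a T-walk by one more
  -- edge inside the remaining vertices.
  NoIsolated : List V → Set
  NoIsolated xs = ∀ {x} → x ∈ xs → ∃[ y ] y ∈ xs × t x y ≡ true

  -- The second alternative does not assert equality; it keeps the structure available until some
  -- step turns strict. Strictness, once obtained, persists under all further steps.
  Outcome : List V → Set
  Outcome xs = ∃[ c ] (cost xs c < # xs * # xs ⊎ (cost xs c ≤ # xs * # xs × NoIsolated xs × Blocks xs))

  rest-< : ∀ s xs {x} → x ∈ xs → s x ≡ true → # rest s xs < # xs
  rest-< s xs x∈ sx = subst (# rest s xs <_) (sym (length-partition s xs))
    (+-monoˡ-≤ (# rest s xs) (∈⇒0<length (∈-filterᵇ⁺ s x∈ sx)))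

  cost≤ : ∀ {xs} (o : Outcome xs) → cost xs (proj₁ o) ≤ # xs * # xs
  cost≤ (c , inj₁ lt)       = <⇒≤ lt
  cost≤ (c , inj₂ (le , _)) = le

  -- Peeling off z alone costs nothing, as there are no T-edges, and gains at least 1.
  edgeless : ∀ {z xs} → z ∈ xs → (∀ {x y} → x ∈ xs → y ∈ xs → t x y ≡ false) →
    (∀ s → s z ≡ true → Outcome (rest s xs)) → Outcome xs
  edgeless {z} {xs} z∈ none ih = let c , lt = peeled in c , inj₁ lt
    where
    α s : V → Bool
    α x = does (x ≟ z)
    -- The disjunct `false` is the empty second class, so that `s` has the form used in peeling.
    s x = α x ∨ false
    α-indep : ∀ {x y} → α x ≡ true → α y ≡ true → a x y ≡ false
    α-indep {x} {y} _ _ with x ≟ z | y ≟ z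
    ... | yes refl | yes refl = a-irrefl z
    sz : s z ≡ true
    sz = cong (_∨ false) (dec-true (z ≟ z) refl)
    in′ out : List V
    in′ = filterᵇ s xs
    out = rest s xs
    loss≡0 : loss s xs ≡ 0
    loss≡0 = cong₂ (λ k l → 2 * k + 4 * l)
      (pairs-zero {xs = in′} {in′} λ x∈ y∈ → none (proj₁ (∈-filterᵇ⁻ s xs x∈)) (proj₁ (∈-filterᵇ⁻ s xs y∈)))
      (pairs-zero {xs = in′} {out} λ x∈ y∈ → none (proj₁ (∈-filterᵇ⁻ s xs x∈)) (proj₁ (∉-filterᵇ s xs y∈)))
    0<in : 0 < # in′
    0<in = ∈⇒0<length (∈-filterᵇ⁺ s z∈ sz)
    loss<gain : loss s xs < gain s xs
    loss<gain = subst (_< gain s xs) (sym loss≡0) (≤-trans (*-mono-≤ 0<in 0<in) (m≤m+n _ _))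
    peeled : ∃[ c ] cost xs c < # xs * # xs
    peeled = peel-< α (const false) α-indep (λ ()) xs (proj₁ (ih s sz)) (+-mono-≤-< (cost≤ (ih s sz)) loss<gain)

  module Tight {xs : List V} (unique : Unique xs) {u v : V} (u∈ : u ∈ xs) (v∈ : v ∈ xs) (uv : t u v ≡ true)
    (no-slack : ∀ {u v} → u ∈ xs → v ∈ xs → t u v ≡ true → gain (nbrs u v) xs ≤ loss (nbrs u v) xs) where

    s : V → Bool
    s = nbrs u v

    in′ out : List V
    in′ = filterᵇ s xs
    out = rest s xs

    ∈in⁻ : ∀ {x} → x ∈ in′ → x ∈ xs × (t u x ≡ true ⊎ t v x ≡ true)
    ∈in⁻ {x} x∈ with t u x | ∈-filterᵇ⁻ s xs x∈
    ... | true  | x∈xs , _  = x∈xs , inj₁ refl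
    ... | false | x∈xs , vx = x∈xs , inj₂ vx

    ∈out⁻ : ∀ {x} → x ∈ out → x ∈ xs × t u x ≡ false × t v x ≡ false
    ∈out⁻ {x} x∈ with t u x | ∉-filterᵇ s xs x∈
    ... | false | x∈xs , vx = x∈xs , refl , vx

    slack : ∀ {u v} → u ∈ xs → v ∈ xs →
            ⟦ t u v ⟧ * gain (nbrs u v) xs ≤ ⟦ t u v ⟧ * loss (nbrs u v) xs
    slack {u} {v} u∈ v∈ with t u v in uv
    ... | true  = *-monoʳ-≤ 1 (no-slack u∈ v∈ uv)
    ... | false = z≤n

    totalGain≤totalLoss : totalGain xs ≤ totalLoss xs
    totalGain≤totalLoss = ∑-mono-≤ {xs = xs} λ u∈ → ∑-mono-≤ {xs = xs} λ v∈ → slack u∈ v∈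

    -- If gain were below loss at `uv`, no other edge would have slack to compensate, and total gain
    -- would be below total loss, against the averaging bound.
    loss≤gain : loss s xs ≤ gain s xs
    loss≤gain = ≮⇒≥ λ gain<loss → <⇒≱ (∑-mono-< {xs = xs}
      (λ u∈ → ∑-mono-≤ {xs = xs} λ v∈ → slack u∈ v∈) u∈
      (∑-mono-< {xs = xs} (λ v∈ → slack u∈ v∈) v∈ (lt gain<loss))) (totalLoss≤totalGain xs)
      where
      lt : gain s xs < loss s xs → ⟦ t u v ⟧ * gain s xs < ⟦ t u v ⟧ * loss s xs
      lt rewrite uv = *-monoʳ-< 1

    module _ (noIsolated : NoIsolated out) where

      -- Otherwise w has a T-neighbour w′ in `out`, and the walk that reaches w through x, prolonged
      -- to w′, makes total loss smaller than total gain, although no edge has slack.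
      no-crossing : ∀ {x w} → x ∈ in′ → w ∈ out → t x w ≡ false
      no-crossing {x} {w} x∈ w∈ with t x w in xw
      ... | false = refl
      ... | true with ∈in⁻ x∈ | ∈out⁻ w∈ | noIsolated w∈
      ...   | x∈xs , ux⊎vx | w∈xs , uw , vw | w′ , w′∈ , ww′ with ∈out⁻ w′∈
      ...     | w′∈xs , uw′ , vw′ = contradiction totalGain≤totalLoss (<⇒≱
        -- For x in N(u) the walk is v u x w, so `u` and `v` trade places.
        ([ (λ ux → totalLoss<totalGain xs v∈ u∈ x∈xs w∈xs w′∈xs (t-sym-true uv) ux xw ww′ vw vw′ uw′)
         , (λ vx → totalLoss<totalGain xs u∈ v∈ x∈xs w∈xs w′∈xs uv vx xw ww′ uw uw′ vw′) ]′ ux⊎vx))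

      du dv tii nio : ℕ
      du = d xs u
      dv = d xs v
      tii = pairs t in′ in′
      nio = pairs non in′ out

      -- This is `no-slack` at `uv`: |S| is du + dv, and by `no-crossing` the crossing part of the
      -- loss is zero.
      [du+dv]²≤2tii : (du + dv) * (du + dv) + 2 * nio ≤ 2 * tii
      [du+dv]²≤2tii = subst₂ _≤_
        (cong (_+ 2 * nio) (cong₂ _*_ (size-nbrs xs uv) (size-nbrs xs uv)))
        (trans (cong (λ k → 2 * tii + 4 * k) (pairs-zero {xs = in′} {out} no-crossing)) (+-identityʳ _))
        (no-slack u∈ v∈ uv)

      tii≡ : tii ≡ (∑[ x ← xs ] ∑[ y ← xs ] (⟦ s x ⟧ * (⟦ s y ⟧ * ⟦ t x y ⟧)))
      tii≡ = trans (∑-filterᵇ s xs _) (∑-cong {xs = xs} λ {x} _ →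
        trans (cong (⟦ s x ⟧ *_) (∑-filterᵇ s xs _)) (*-distribˡ-∑ ⟦ s x ⟧ xs _))

      2dudv≡ : 2 * (du * dv) ≡ (∑[ x ← xs ] ∑[ y ← xs ] (⟦ t u x ⟧ * ⟦ t v y ⟧ + ⟦ t v x ⟧ * ⟦ t u y ⟧))
      2dudv≡ = begin
        2 * (du * dv)                     ≡⟨ arith du dv ⟩
        du * dv + dv * du                 ≡⟨ cong₂ _+_ (∑-product xs xs _ _) (∑-product xs xs _ _) ⟩
        (∑[ x ← xs ] ∑[ y ← xs ] (⟦ t u x ⟧ * ⟦ t v y ⟧)) + (∑[ x ← xs ] ∑[ y ← xs ] (⟦ t v x ⟧ * ⟦ t u y ⟧))
          ≡⟨ ∑-distrib-+ xs _ _ ⟨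
        (∑[ x ← xs ] ((∑[ y ← xs ] (⟦ t u x ⟧ * ⟦ t v y ⟧)) + (∑[ y ← xs ] (⟦ t v x ⟧ * ⟦ t u y ⟧))))
          ≡⟨ ∑-cong {xs = xs} (λ _ → sym (∑-distrib-+ xs _ _)) ⟩
        (∑[ x ← xs ] ∑[ y ← xs ] (⟦ t u x ⟧ * ⟦ t v y ⟧ + ⟦ t v x ⟧ * ⟦ t u y ⟧)) ∎
        where
        open ≡-Reasoning
        arith : ∀ m o → 2 * (m * o) ≡ m * o + o * m
        arith = solve-∀

      -- N(u) and N(v) are independent, so a T-edge within their union joins one to the other.
      opposite : ∀ x y → ⟦ s x ⟧ * (⟦ s y ⟧ * ⟦ t x y ⟧) ≤ ⟦ t u x ⟧ * ⟦ t v y ⟧ + ⟦ t v x ⟧ * ⟦ t u y ⟧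
      opposite x y with t x y in xy
      ... | false rewrite *-zeroʳ ⟦ s y ⟧ | *-zeroʳ ⟦ s x ⟧ = z≤n
      ... | true with t u x in ux | t v x in vx | t u y in uy | t v y in vy
      ...   | true  | _     | true  | _     = contradiction (trans (sym (t⇒a xy)) (common-nbr ux uy)) λ ()
      ...   | _     | true  | _     | true  = contradiction (trans (sym (t⇒a xy)) (common-nbr vx vy)) λ ()
      ...   | false | false | _     | _     = z≤n
      ...   | true  | false | false | true  = ≤-refl
      ...   | true  | _     | false | false = z≤n
      ...   | false | true  | true  | false = ≤-refl
      ...   | false | true  | false | false = z≤n

      tii≤2dudv : tii ≤ 2 * (du * dv)
      tii≤2dudv = subst₂ _≤_ (sym tii≡) (sym 2dudv≡)
        (∑-mono-≤ {xs = xs} λ {x} _ → ∑-mono-≤ {xs = xs} λ {y} _ → opposite x y)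

      2tii≤4dudv : 2 * tii ≤ 4 * (du * dv)
      2tii≤4dudv = ≤-trans (*-monoʳ-≤ 2 tii≤2dudv) (≤-reflexive (sym (*-assoc 2 2 (du * dv))))

      -- A missing T-edge between N(u) and N(v) would make `tii≤2dudv` strict, hence 2 tii < 4 du dv
      -- ≤ (du + dv)² ≤ 2 tii.
      complete : ∀ {x y} → x ∈ xs → y ∈ xs → t u x ≡ true → t v y ≡ true → t x y ≡ true
      complete {x} {y} x∈ y∈ ux vy with t x y in xy
      ... | true = refl
      ... | false = contradiction
        (m+n≤o⇒m≤o _ [du+dv]²≤2tii)
        (<⇒≱ (≤-trans 2tii<4dudv (4mo≤[m+o]² du dv)))
        where
        lt : ⟦ s x ⟧ * (⟦ s y ⟧ * ⟦ t x y ⟧) < ⟦ t u x ⟧ * ⟦ t v y ⟧ + ⟦ t v x ⟧ * ⟦ t u y ⟧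
        lt rewrite xy | ux | vy | *-zeroʳ ⟦ t u y ∨ true ⟧ = s≤s z≤n
        2tii<4dudv : 2 * tii < 4 * (du * dv)
        2tii<4dudv = <-≤-trans (*-monoʳ-< 2 (subst₂ _<_ (sym tii≡) (sym 2dudv≡)
          (∑-mono-< {xs = xs} (λ {x} _ → ∑-mono-≤ {xs = xs} λ {y} _ → opposite x y) x∈
            (∑-mono-< {xs = xs} (λ {y} _ → opposite x y) y∈ lt)))) (≤-reflexive (sym (*-assoc 2 2 (du * dv))))

      -- The chain (du + dv)² ≤ 2 tii ≤ 4 du dv is the equality case of AM-GM.
      balanced : du ≡ dv
      balanced = [m+o]²≤4mo⇒m≡o du dv (≤-trans (m+n≤o⇒m≤o _ [du+dv]²≤2tii) 2tii≤4dudv)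

      -- The same chain returns to (du + dv)², which leaves no room for the summand 2 nio.
      nio≡0 : nio ≡ 0
      nio≡0 = n≤0⇒n≡0 (*-cancelˡ-≤ 2 (+-cancelˡ-≤ ((du + dv) * (du + dv)) (2 * nio) (2 * 0)
        (≤-trans [du+dv]²≤2tii (≤-trans 2tii≤4dudv (≤-trans (4mo≤[m+o]² du dv) (m≤m+n _ _))))))

      joined : ∀ {x w} → x ∈ in′ → w ∈ out → a x w ≡ true
      joined x∈ w∈ = Bool.not-injective (⟦⟧≡0 (∑≡0⇒≡0 (∑≡0⇒≡0 nio≡0 x∈) w∈))

      noIsolated-xs : NoIsolated xs
      noIsolated-xs {x} x∈ with t u x in ux | t v x in vx
      ... | true  | _     = u , u∈ , t-sym-true ux
      ... | false | true  = v , v∈ , t-sym-true vx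
      ... | false | false with noIsolated (∈-filterᵇ⁺ {xs = xs} (not ∘ s) x∈ (cong not (cong₂ _∨_ ux vx)))
      ...   | y , y∈ , xy = y , proj₁ (∈out⁻ y∈) , xy

      module _ (blocks : Blocks out) where
        open Blocks blocks
        As Bs : List V
        As = filterᵇ (t u) xs
        Bs = filterᵇ (t v) xs

        #As≡#Bs : # As ≡ # Bs
        #As≡#Bs = trans (∑-length-filterᵇ (t u) xs) (trans balanced (sym (∑-length-filterᵇ (t v) xs)))

        -- Both sides are indexed by the length of `As`; balance permits the cast into `Bs`.
        first : Fin (# As) ⊎ Fin (# As) → V
        first (inj₁ i) = lookup As i
        first (inj₂ i) = lookup Bs (cast #As≡#Bs i)

        ∈As : ∀ i → lookup As i ∈ xs × t u (lookup As i) ≡ true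
        ∈As i = ∈-filterᵇ⁻ (t u) xs (∈-lookup i)

        ∈Bs : ∀ i → lookup Bs i ∈ xs × t v (lookup Bs i) ≡ true
        ∈Bs i = ∈-filterᵇ⁻ (t v) xs (∈-lookup i)

        first-∈ : ∀ p → first p ∈ in′
        first-∈ (inj₁ i) = ∈-filterᵇ⁺ {xs = xs} s (proj₁ (∈As i)) (cong (_∨ t v (lookup As i)) (proj₂ (∈As i)))
        first-∈ (inj₂ i) = ∈-filterᵇ⁺ {xs = xs} s (proj₁ (∈Bs (cast #As≡#Bs i)))
          (trans (cong (t u (first (inj₂ i)) ∨_) (proj₂ (∈Bs (cast #As≡#Bs i)))) (Bool.∨-zeroʳ (t u (first (inj₂ i)))))

        opposite-sides : ∀ i j → a (lookup As i) (lookup Bs j) ≡ true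
        opposite-sides i j = t⇒a (complete (proj₁ (∈As i)) (proj₁ (∈Bs j)) (proj₂ (∈As i)) (proj₂ (∈Bs j)))

        first-injective : ∀ {p q} → first p ≡ first q → p ≡ q
        first-injective {inj₁ i} {inj₁ j} eq = cong inj₁ (lookup-injective (filter⁺ _ unique) eq)
        first-injective {inj₁ i} {inj₂ j} eq = contradiction
          (trans (sym (opposite-sides i (cast #As≡#Bs j))) (trans (cong (flip a _) eq) (a-irrefl _))) λ ()
        first-injective {inj₂ i} {inj₁ j} eq = contradiction
          (trans (sym (opposite-sides j (cast #As≡#Bs i))) (trans (cong (flip a _) (sym eq)) (a-irrefl _))) λ ()
        first-injective {inj₂ i} {inj₂ j} eq = cong inj₂ (cast-injective (lookup-injective (filter⁺ _ unique) eq))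
          where
          cast-injective : cast #As≡#Bs i ≡ cast #As≡#Bs j → i ≡ j
          cast-injective eq = trans (sym (uncast i)) (trans (cong (cast (sym #As≡#Bs)) eq) (uncast j))
            where
            uncast : ∀ i → cast (sym #As≡#Bs) (cast #As≡#Bs i) ≡ i
            uncast i = trans (cast-trans #As≡#Bs (sym #As≡#Bs) i) (cast-is-id refl i)

        blocks-xs : Blocks xs
        blocks-xs = record
          { k            = suc k
          ; size         = size-xs
          -- The new block is non-empty because `v` itself lies in N(u).
          ; positive     = λ { zero → ∈⇒0<length (∈-filterᵇ⁺ (t u) v∈ uv) ; (suc i) → positive i }
          ; at           = at-xs
          ; at-∈         = λ { zero p → proj₁ (∈-filterᵇ⁻ s xs (first-∈ p)) ; (suc i) p → proj₁ (∈out⁻ (at-∈ i p)) }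
          ; at-onto      = onto
          ; at-injective = λ { zero → first-injective ; (suc i) → at-injective i }
          ; inner       = λ where
              zero (inj₁ i) (inj₁ j) → common-nbr (proj₂ (∈As i)) (proj₂ (∈As j))
              zero (inj₁ i) (inj₂ j) → opposite-sides i _
              zero (inj₂ i) (inj₁ j) → trans (a-sym _ _) (opposite-sides j _)
              zero (inj₂ i) (inj₂ j) → common-nbr (proj₂ (∈Bs _)) (proj₂ (∈Bs _))
              (suc i) p q → inner i p q
          ; outer        = outer-xs
          }
          where
          size-xs : Fin (suc k) → ℕ
          size-xs zero    = # As
          size-xs (suc i) = size i
          at-xs : ∀ i → Fin (size-xs i) ⊎ Fin (size-xs i) → V
          at-xs zero    = first
          at-xs (suc i) = at i
          outer-xs : ∀ {i j} → i ≢ j → ∀ p q → a (at-xs i p) (at-xs j q) ≡ true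
          outer-xs {zero}  {zero}  i≢j p q = contradiction refl i≢j
          outer-xs {zero}  {suc j} i≢j p q = joined (first-∈ p) (at-∈ j q)
          outer-xs {suc i} {zero}  i≢j p q = trans (a-sym _ _) (joined (first-∈ q) (at-∈ i p))
          outer-xs {suc i} {suc j} i≢j p q = outer (i≢j ∘ cong suc) p q
          onto : ∀ {x} → x ∈ xs → ∃[ i ] ∃[ p ] at-xs i p ≡ x
          onto {x} x∈ with t u x in ux | t v x in vx
          ... | true | _ = let x∈As = ∈-filterᵇ⁺ {xs = xs} (t u) x∈ ux in
            zero , inj₁ (index x∈As) , sym (lookup-index x∈As)
          ... | false | true = let x∈Bs = ∈-filterᵇ⁺ {xs = xs} (t v) x∈ vx in
            zero , inj₂ (cast (sym #As≡#Bs) (index x∈Bs)) ,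
            trans (cong (lookup Bs) (trans (cast-trans (sym #As≡#Bs) #As≡#Bs _) (cast-is-id refl _))) (sym (lookup-index x∈Bs))
          ... | false | false with at-onto (∈-filterᵇ⁺ {xs = xs} (not ∘ s) x∈ (cong not (cong₂ _∨_ ux vx)))
          ...   | i , p , eq = suc i , p , eq

  -- Three cases. Without T-edges a single vertex is peeled off. An edge with loss < gain gives a
  -- strict bound. If no edge has slack, any edge serves: a strict rest stays strict, and the
  -- structure of a tight rest extends to `xs`.
  step : ∀ {z xs} → Unique xs → z ∈ xs → (∀ s {x} → x ∈ xs → s x ≡ true → Outcome (rest s xs)) → Outcome xs
  step {z} {xs} unique z∈ ih = by-edges (search₂ edge? xs)
    where
    edge? : ∀ u v → Dec (t u v ≡ true)
    edge? u v = t u v Bool.≟ true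
    Slack : V → V → Set
    Slack u v = t u v ≡ true × loss (nbrs u v) xs < gain (nbrs u v) xs
    slack? : ∀ u v → Dec (Slack u v)
    slack? u v = edge? u v ×-dec (loss (nbrs u v) xs <? gain (nbrs u v) xs)
    ih-nbrs : ∀ {u v} → v ∈ xs → t u v ≡ true → Outcome (rest (nbrs u v) xs)
    -- `v` lies in N(u), so the rest is strictly shorter.
    ih-nbrs {u} {v} v∈ uv = ih (nbrs u v) v∈ (cong (_∨ t v v) uv)
    by-slack : ∀ {u v} → u ∈ xs → v ∈ xs → t u v ≡ true →
               (∃[ u ] ∃[ v ] u ∈ xs × v ∈ xs × Slack u v) ⊎ (∀ {u v} → u ∈ xs → v ∈ xs → ¬ Slack u v) → Outcome xs
    by-slack _ _ _ (inj₁ (u , v , u∈ , v∈ , uv , loss<gain)) =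
      let c , lt = peel-< (t u) (t v) common-nbr common-nbr xs (proj₁ (ih-nbrs v∈ uv))
                     (+-mono-≤-< (cost≤ (ih-nbrs v∈ uv)) loss<gain)
      in c , inj₁ lt
    by-slack {u} {v} u∈ v∈ uv (inj₂ none) = finish (ih-nbrs v∈ uv)
      where
      open Tight unique u∈ v∈ uv (λ u∈ v∈ uv → ≮⇒≥ λ lt → none u∈ v∈ (uv , lt))
      finish : Outcome out → Outcome xs
      finish (c′ , inj₁ lt) =
        let c , lt′ = peel-< (t u) (t v) common-nbr common-nbr xs c′ (+-mono-<-≤ lt loss≤gain)
        in c , inj₁ lt′
      finish (c′ , inj₂ (le , noIsolated , blocks)) =
        let c , le′ = peel-≤ (t u) (t v) common-nbr common-nbr xs c′ le loss≤gain
        in c , inj₂ (le′ , noIsolated-xs noIsolated , blocks-xs noIsolated blocks)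
    by-edges : (∃[ u ] ∃[ v ] u ∈ xs × v ∈ xs × t u v ≡ true) ⊎ (∀ {u v} → u ∈ xs → v ∈ xs → ¬ t u v ≡ true) → Outcome xs
    by-edges (inj₁ (u , v , u∈ , v∈ , uv)) = by-slack u∈ v∈ uv (search₂ slack? xs)
    by-edges (inj₂ none) = edgeless z∈ (λ x∈ y∈ → Bool.¬-not (none x∈ y∈)) λ s → ih s z∈

  -- The bound `m` on the length is the recursion argument, since `rest s xs` is not a subterm of
  -- `xs`.
  outcome : ∀ m xs → # xs ≤ m → Unique xs → Outcome xs
  -- The empty list attains the bound 0, as the join of no blocks.
  outcome m []       _ _ = const true , inj₂ (z≤n , (λ ()) , record
    { k = 0 ; size = λ () ; positive = λ () ; at = λ () ; at-∈ = λ () ; at-onto = λ ()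
    ; at-injective = λ () ; inner = λ () ; outer = λ { {()} } })
  outcome (suc m) (z ∷ zs) le unique = step unique (here refl) λ s x∈ sx →
    outcome m (rest s (z ∷ zs)) (≤-pred (≤-trans (rest-< s (z ∷ zs) x∈ sx) le)) (filter⁺ (Bool.T? ∘ not ∘ s) unique)

-- Counting monochromatic pairs and sums over subsets.

does-true⁻ : ∀ {P : Set} (P? : Dec P) → does P? ≡ true → P
does-true⁻ (yes p) _ = p

⟦⟧-mono : ∀ {b c} → (b ≡ true → c ≡ true) → ⟦ b ⟧ ≤ ⟦ c ⟧
⟦⟧-mono {true}  imp rewrite imp refl = ≤-refl
⟦⟧-mono {false} imp = z≤n

≡-fromImps : ∀ {b c} → (b ≡ true → c ≡ true) → (c ≡ true → b ≡ true) → b ≡ c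
≡-fromImps {true}  {c}     f g = sym (f refl)
≡-fromImps {false} {true}  f g = g refl
≡-fromImps {false} {false} f g = refl

pairs-mono : ∀ {r s : A → A → Bool} {xs ys} → (∀ {x y} → r x y ≡ true → s x y ≡ true) →
             pairs r xs ys ≤ pairs s xs ys
pairs-mono {xs = xs} {ys} imp = ∑-mono-≤ {xs = xs} λ _ → ∑-mono-≤ {xs = ys} λ _ → ⟦⟧-mono imp

∑-++ : ∀ xs ys (f : A → ℕ) → ∑ (xs ++ ys) f ≡ ∑ xs f + ∑ ys f
∑-++ xs ys f = trans (cong sum (map-++ f xs ys)) (sum-++ (map f xs) (map f ys))

∑-map : ∀ xs (g : A → B) (f : B → ℕ) → ∑ (map g xs) f ≡ ∑ xs (f ∘ g)
∑-map []       g f = refl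
∑-map (x ∷ xs) g f = cong (f (g x) +_) (∑-map xs g f)

∑-cartesianProduct : ∀ xs ys (f : A × B → ℕ) →
  ∑ (cartesianProduct xs ys) f ≡ (∑[ x ← xs ] ∑[ y ← ys ] f (x , y))
∑-cartesianProduct []       ys f = refl
∑-cartesianProduct (x ∷ xs) ys f = trans (∑-++ (map (x ,_) ys) _ f)
  (cong₂ _+_ (∑-map ys (x ,_) f) (∑-cartesianProduct xs ys f))

∑-tabulate : ∀ {n} (g : Fin n → A) (f : A → ℕ) → ∑ (tabulate g) f ≡ sumᶠ (f ∘ g)
∑-tabulate {n = zero}  g f = refl
∑-tabulate {n = suc n} g f = cong (f (g zero) +_) (∑-tabulate (g ∘ suc) f)

∑-permute : ∀ {n} (π : Permutation′ n) f → ∑ (allFin n) f ≡ ∑ (allFin n) (λ x → f (π ⟨$⟩ʳ x))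
∑-permute π f = trans (∑-tabulate (λ i → i) f) (trans (sum-permute f π) (sym (∑-tabulate (λ i → i) (λ x → f (π ⟨$⟩ʳ x)))))

∣tabulate-lookup∣ : ∀ (es : List A) (p : A → Bool) → ∣ Vec.tabulate (p ∘ lookup es) ∣ ≡ (∑[ e ← es ] ⟦ p e ⟧)
∣tabulate-lookup∣ []       p = refl
∣tabulate-lookup∣ (x ∷ es) p with p x
... | true  = cong suc (∣tabulate-lookup∣ es p)
... | false = ∣tabulate-lookup∣ es p

module _ {V : Set} (c : V → Bool) where

  same : V → V → Bool
  same x y = not (c x xor c y)

  -- Colour classes of sizes m and o contain m² + o² ordered pairs, and 2mo ≤ m² + o².
  pairs-same : ∀ xs → # xs * # xs ≤ 2 * pairs same xs xs
  pairs-same xs = begin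
    # xs * # xs                    ≡⟨ cong (λ k → k * k) size ⟩
    (m + o) * (m + o)              ≡⟨ arith₁ m o ⟩
    2 * (m * o) + (m * m + o * o)  ≤⟨ +-monoˡ-≤ _ (2mo≤m²+o² m o) ⟩
    (m * m + o * o) + (m * m + o * o) ≡⟨ n+n≡2*n (m * m + o * o) ⟩
    2 * (m * m + o * o)            ≡⟨ cong (2 *_) split ⟨
    2 * pairs same xs xs           ∎
    where
    open ≤-Reasoning
    m = ∑[ x ← xs ] ⟦ c x ⟧
    o = ∑[ x ← xs ] ⟦ not (c x) ⟧
    size : # xs ≡ m + o
    size = trans (sym (∑-one xs)) (trans (∑-cong {xs = xs} λ {x} _ → 1≡⟦b⟧+⟦not-b⟧ (c x)) (∑-distrib-+ xs _ _))
    arith₁ : ∀ m o → (m + o) * (m + o) ≡ 2 * (m * o) + (m * m + o * o)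
    arith₁ = solve-∀
    agree : ∀ b b′ → ⟦ not (b xor b′) ⟧ ≡ ⟦ b ⟧ * ⟦ b′ ⟧ + ⟦ not b ⟧ * ⟦ not b′ ⟧
    agree true  true  = refl
    agree true  false = refl
    agree false true  = refl
    agree false false = refl
    split : pairs same xs xs ≡ m * m + o * o
    split = trans
      (∑-cong {xs = xs} λ {x} _ → trans (∑-cong {xs = xs} λ {y} _ → agree (c x) (c y)) (∑-distrib-+ xs _ _))
      (trans (∑-distrib-+ xs _ _) (sym (cong₂ _+_ (∑-product xs xs _ _) (∑-product xs xs _ _))))

  -- A monochromatic pair is an uncut edge or a non-adjacent pair.
  pairs-uncut : ∀ (a : V → V → Bool) xs →
    # xs * # xs ≤ 2 * pairs (uncut a c) xs xs + 2 * pairs (λ x y → not (a x y)) xs xs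
  pairs-uncut a xs = ≤-trans (pairs-same xs) (≤-trans (*-monoʳ-≤ 2 le) (≤-reflexive (*-distribˡ-+ 2 (pairs (uncut a c) xs xs) _)))
    where
    pointwise : ∀ b b′ → ⟦ b′ ⟧ ≤ ⟦ b ∧ b′ ⟧ + ⟦ not b ⟧
    pointwise true  b′    = m≤m+n _ 0
    pointwise false true  = ≤-refl
    pointwise false false = z≤n
    le : pairs same xs xs ≤ pairs (uncut a c) xs xs + pairs (λ x y → not (a x y)) xs xs
    le = subst (pairs same xs xs ≤_)
      (trans (∑-cong {xs = xs} λ _ → ∑-distrib-+ xs _ _) (∑-distrib-+ xs _ _))
      (∑-mono-≤ {xs = xs} λ {x} _ → ∑-mono-≤ {xs = xs} λ {y} _ → pointwise (a x y) (same x y))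

-- Edge sets as symmetric Boolean relations.

module EdgeSets {n : ℕ} (G : Graph (Fin n)) where
  open Graph G

  V : List (Fin n)
  V = allFin n

  adj : Fin n → Fin n → Bool
  adj x y = does (x ~? y)

  adj-sym : ∀ x y → adj x y ≡ adj y x
  adj-sym x y = does-⇔ (mk⇔ ~-sym ~-sym) (x ~? y) (y ~? x)

  adj-irrefl : ∀ x → adj x x ≡ false
  adj-irrefl x = dec-false (x ~? x) ~-irrefl

  -- Repeats the filter predicate of `edges`, so that membership in `edges G` can be taken apart.
  listed? : ∀ (e : Fin n × Fin n) → Dec (proj₁ e Fin.< proj₂ e × proj₁ e ~ proj₂ e)
  listed? (x , y) = x Fin.<? y ×-dec x ~? y

  edge-listed : ∀ e {x y} → lookup (edges G) e ≡ (x , y) → x Fin.< y × x ~ y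
  edge-listed e eq = proj₂ (∈-filter⁻ listed? {xs = cartesianProduct V V} (subst (_∈ edges G) eq (∈-lookup e)))

  Joins-sym : ∀ {e x y} → Joins G e x y → Joins G e y x
  Joins-sym = swap

  Joins⇒~ : ∀ {e x y} → Joins G e x y → x ~ y
  Joins⇒~ {e} (inj₁ eq) = proj₂ (edge-listed e eq)
  Joins⇒~ {e} (inj₂ eq) = ~-sym (proj₂ (edge-listed e eq))

  -- The edge list has no repetitions, and opposite orientations cannot both have the smaller
  -- endpoint first.
  Joins-injective : ∀ {e f x y} → Joins G e x y → Joins G f x y → e ≡ f
  Joins-injective {e} {f} (inj₁ p) (inj₁ q) = lookup-injective edges-unique (trans p (sym q))
    where
    edges-unique : Unique (edges G)
    edges-unique = filter⁺ listed? (cartesianProduct⁺ (allFin⁺ n) (allFin⁺ n))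
  Joins-injective {e} {f} (inj₂ p) (inj₂ q) = Joins-injective {e} {f} (inj₁ p) (inj₁ q)
  Joins-injective {e} {f} (inj₁ p) (inj₂ q) =
    contradiction (proj₁ (edge-listed f q)) (Fin.<-asym (proj₁ (edge-listed e p)))
  Joins-injective {e} {f} (inj₂ p) (inj₁ q) =
    contradiction (proj₁ (edge-listed f q)) (Fin.<-asym (proj₁ (edge-listed e p)))

  linked? : ∀ P x y → Dec (∃[ e ] (e ∈ₛ P × Joins G e x y))
  linked? P x y = any? λ e → (e ∈ₛ? P) ×-dec joins? G e x y

  linked : EdgeSet G → Fin n → Fin n → Bool
  linked P x y = does (linked? P x y)

  linked-sym : ∀ P x y → linked P x y ≡ linked P y x
  linked-sym P x y = does-⇔ (mk⇔ flipped flipped) (linked? P x y) (linked? P y x)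
    where
    flipped : ∀ {x y} → ∃[ e ] (e ∈ₛ P × Joins G e x y) → ∃[ e ] (e ∈ₛ P × Joins G e y x)
    flipped (e , e∈ , j) = e , e∈ , Joins-sym {e} j

  linked⇒adj : ∀ P {x y} → linked P x y ≡ true → adj x y ≡ true
  linked⇒adj P {x} {y} xy = let e , _ , j = does-true⁻ (linked? P x y) xy in dec-true (x ~? y) (Joins⇒~ {e} j)

  -- Together with `linked` this translates between subsets of the edge list and relations, where
  -- sizes become values of `pairs`.
  select : (Fin n → Fin n → Bool) → EdgeSet G
  select r = Vec.tabulate λ e → uncurry r (lookup (edges G) e)

  ∈-select⁺ : ∀ r → (∀ x y → r x y ≡ r y x) → ∀ {e x y} → Joins G e x y → r x y ≡ true → e ∈ₛ select r
  ∈-select⁺ r r-sym {e} {x} {y} j xy = Vec.lookup⇒[]= e _ (trans (Vec.lookup∘tabulate _ e) (at j))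
    where
    at : Joins G e x y → uncurry r (lookup (edges G) e) ≡ true
    at (inj₁ eq) = trans (cong (uncurry r) eq) xy
    at (inj₂ eq) = trans (cong (uncurry r) eq) (trans (r-sym y x) xy)

  ∈-select⁻ : ∀ r → (∀ x y → r x y ≡ r y x) → ∀ {e x y} → Joins G e x y → e ∈ₛ select r → r x y ≡ true
  ∈-select⁻ r r-sym {e} {x} {y} j e∈ with trans (sym (Vec.lookup∘tabulate _ e)) (Vec.[]=⇒lookup e∈)
  ∈-select⁻ r r-sym {e} {x} {y} (inj₁ eq) e∈ | at = trans (sym (cong (uncurry r) eq)) at
  ∈-select⁻ r r-sym {e} {x} {y} (inj₂ eq) e∈ | at = trans (r-sym x y) (trans (sym (cong (uncurry r) eq)) at)

  select-linked : ∀ P → select (linked P) ≡ P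
  select-linked P = trans (Vec.tabulate-cong at) (Vec.tabulate∘lookup P)
    where
    at : ∀ e → uncurry (linked P) (lookup (edges G) e) ≡ Vec.lookup P e
    at e = ≡-fromImps
      (λ xy → let f , f∈ , j = does-true⁻ (linked? P _ _) xy in
        trans (cong (Vec.lookup P) (Joins-injective {e} {f} (inj₁ refl) j)) (Vec.[]=⇒lookup f∈))
      (λ e∈ → dec-true (linked? P _ _) (e , Vec.lookup⇒[]= e P e∈ , inj₁ refl))

  -- The sum over the edge list is the sum of `up` over ordered pairs, each edge appearing in
  -- increasing order only. Adding the transposed sum recovers `r` off the diagonal; on it `r`
  -- vanishes because it implies adjacency.
  2∣select∣ : ∀ r → (∀ x y → r x y ≡ r y x) → (∀ {x y} → r x y ≡ true → adj x y ≡ true) →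
              2 * ∣ select r ∣ ≡ pairs r V V
  2∣select∣ r r-sym r⇒adj = begin
    2 * ∣ select r ∣              ≡⟨ cong (2 *_) (∣tabulate-lookup∣ (edges G) (uncurry r)) ⟩
    2 * (∑[ e ← edges G ] ⟦ uncurry r e ⟧) ≡⟨ cong (2 *_) (trans (∑-filter listed? (cartesianProduct V V) _) (∑-cartesianProduct V V _)) ⟩
    2 * (∑[ x ← V ] ∑[ y ← V ] up x y)    ≡⟨ cong ((∑[ x ← V ] ∑[ y ← V ] up x y) +_) (trans (+-identityʳ _) (∑-swap V V _)) ⟩
    (∑[ x ← V ] ∑[ y ← V ] up x y) + (∑[ x ← V ] ∑[ y ← V ] up y x)
      ≡⟨ ∑-distrib-+ V _ _ ⟨
    (∑[ x ← V ] ((∑[ y ← V ] up x y) + (∑[ y ← V ] up y x)))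
      ≡⟨ ∑-cong {xs = V} (λ {x} _ → trans (sym (∑-distrib-+ V _ _)) (∑-cong {xs = V} λ {y} _ → oriented x y)) ⟩
    pairs r V V                   ∎
    where
    open ≡-Reasoning
    up : Fin n → Fin n → ℕ
    up x y = ⟦ does (listed? (x , y)) ⟧ * ⟦ r x y ⟧
    ¬adj⇒¬r : ∀ {x y} → ¬ (x ~ y) → r x y ≡ false
    ¬adj⇒¬r {x} {y} x≁y with r x y in xy
    ... | true  = contradiction (does-true⁻ (x ~? y) (r⇒adj xy)) x≁y
    ... | false = refl
    up-< : ∀ {x y} → x Fin.< y → up x y ≡ ⟦ r x y ⟧
    up-< {x} {y} x<y with x ~? y
    ... | yes x~y rewrite dec-true (x Fin.<? y) x<y = +-identityʳ _
    ... | no  x≁y rewrite ¬adj⇒¬r x≁y = *-zeroʳ ⟦ does (x Fin.<? y) ∧ false ⟧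
    up-≮ : ∀ {x y} → ¬ (x Fin.< y) → up x y ≡ 0
    up-≮ {x} {y} x≮y rewrite dec-false (x Fin.<? y) x≮y = refl
    oriented : ∀ x y → up x y + up y x ≡ ⟦ r x y ⟧
    oriented x y with Fin.<-cmp x y
    ... | tri< x<y _ y≮x rewrite up-< x<y | up-≮ y≮x = +-identityʳ _
    ... | tri> x≮y _ y<x rewrite up-< y<x | up-≮ x≮y = cong ⟦_⟧ (r-sym y x)
    ... | tri≈ x≮x refl _ rewrite up-≮ x≮x | ¬adj⇒¬r (~-irrefl {x}) = refl

  2∣P∣ : ∀ P → 2 * ∣ P ∣ ≡ pairs (linked P) V V
  2∣P∣ P = trans (cong (λ Q → 2 * ∣ Q ∣) (sym (select-linked P))) (2∣select∣ (linked P) (linked-sym P) (linked⇒adj P))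

  -- If x and z were adjacent, x, y, z would be a triangle and independence would identify its two
  -- T-edges. One edge joining both x, y and y, z forces a loop.
  linked-walk : ∀ {T} → TriangleIndependent G T → ∀ {x y z} →
    linked T x y ≡ true → linked T y z ≡ true → adj x z ≡ false
  linked-walk {T} indep {x} {y} {z} xy yz with x ~? z
  ... | no  _   = refl
  ... | yes x~z with does-true⁻ (linked? T x y) xy | does-true⁻ (linked? T y z) yz
  ...   | e , e∈ , j | f , f∈ , l
    with indep x y z (Joins⇒~ {e} j , Joins⇒~ {f} l , ~-sym x~z) e f e∈ f∈ (inj₁ j) (inj₂ (inj₁ l))
  ...     | refl = ⊥-elim (shared j l)
    where
    shared : Joins G e x y → Joins G e y z → ⊥
    shared (inj₁ p) (inj₁ q) with trans (sym p) q
    ... | refl = contradiction (Joins⇒~ {e} j) ~-irrefl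
    shared (inj₁ p) (inj₂ q) with trans (sym p) q
    ... | refl = contradiction x~z ~-irrefl
    shared (inj₂ p) (inj₁ q) with trans (sym p) q
    ... | refl = contradiction x~z ~-irrefl
    shared (inj₂ p) (inj₂ q) with trans (sym p) q
    ... | refl = contradiction (Joins⇒~ {e} j) ~-irrefl

  -- Two different sides of a triangle share a vertex, and the third side joins the ends of the
  -- resulting walk in `r`. The cases of `same-edge` turn the sides so that the shared vertex is in
  -- the middle.
  select-independent : ∀ r → (∀ x y → r x y ≡ r y x) →
    (∀ {x y z} → r x y ≡ true → r y z ≡ true → adj x z ≡ false) → TriangleIndependent G (select r)
  select-independent r r-sym r-walk u v w (u~v , v~w , w~u) e f e∈ f∈ = same-edge
    where
    meet : ∀ {x y z} → Joins G e x y → Joins G f y z → x ~ z → e ≡ f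
    meet {x} {y} {z} j l x~z = contradiction
      (trans (sym (dec-true (x ~? z) x~z)) (r-walk (∈-select⁻ r r-sym {e} j e∈) (∈-select⁻ r r-sym {f} l f∈))) λ ()
    sw : ∀ {e x y} → Joins G e x y → Joins G e y x
    sw {e} = Joins-sym {e}
    same-edge : EdgeOfTriangle G e u v w → EdgeOfTriangle G f u v w → e ≡ f
    same-edge (inj₁ j)        (inj₁ l)        = Joins-injective {e} {f} j l
    same-edge (inj₁ j)        (inj₂ (inj₁ l)) = meet j l (~-sym w~u)
    same-edge (inj₁ j)        (inj₂ (inj₂ l)) = meet (sw {e} j) (sw {f} l) v~w
    same-edge (inj₂ (inj₁ j)) (inj₁ l)        = meet (sw {e} j) (sw {f} l) w~u
    same-edge (inj₂ (inj₁ j)) (inj₂ (inj₁ l)) = Joins-injective {e} {f} j l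
    same-edge (inj₂ (inj₁ j)) (inj₂ (inj₂ l)) = meet j l (~-sym u~v)
    same-edge (inj₂ (inj₂ j)) (inj₁ l)        = meet j l (~-sym v~w)
    same-edge (inj₂ (inj₂ j)) (inj₂ (inj₁ l)) = meet (sw {e} j) (sw {f} l) u~v
    same-edge (inj₂ (inj₂ j)) (inj₂ (inj₂ l)) = Joins-injective {e} {f} j l

  uncut-bipartite : ∀ c → Bipartite (_∖_ G (select (uncut adj c)))
  uncut-bipartite c = c , λ u v (u~v , kept) cu≡cv → let e , j = joining-edge G u~v in
    kept (e , ∈-select⁺ (uncut adj c) (uncut-sym adj adj-sym c) {e} j (monochromatic u~v cu≡cv) , j)
    where
    monochromatic : ∀ {u v} → u ~ v → c u ≡ c v → uncut adj c u v ≡ true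
    monochromatic {u} {v} u~v cu≡cv rewrite dec-true (u ~? v) u~v | cu≡cv with c v
    ... | true  = refl
    ... | false = refl

  -- An edge monochromatic in a proper colouring of the remaining graph must have been deleted.
  bipartite-uncut : ∀ {F} ((c , _) : Bipartite (_∖_ G F)) → pairs (uncut adj c) V V ≤ 2 * ∣ F ∣
  bipartite-uncut {F} (c , proper) = ≤-trans (pairs-mono {xs = V} {V} deleted) (≤-reflexive (sym (2∣P∣ F)))
    where
    deleted : ∀ {x y} → uncut adj c x y ≡ true → linked F x y ≡ true
    deleted {x} {y} mono with x ~? y | linked? F x y
    ... | yes x~y | yes _    = refl
    ... | yes x~y | no  kept with c x in cx | c y in cy
    ...   | true  | true  = contradiction (trans cx (sym cy)) (proper x y (x~y , kept))
    ...   | false | false = contradiction (trans cx (sym cy)) (proper x y (x~y , kept))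

-- The bound and its equality case.

module _ {n : ℕ} (G : Graph (Fin n)) where
  open Graph G
  open EdgeSets G

  private
    T : EdgeSet G
    T = proj₁ (maximumTriangleIndependent G)
    t : Fin n → Fin n → Bool
    t = linked T
    open Induct Fin._≟_ adj t adj-sym (linked-sym T) adj-irrefl (linked⇒adj T)
      (linked-walk (proj₁ (proj₂ (maximumTriangleIndependent G))))
    open Peel adj t adj-sym (linked-sym T) using (cost)

    best : Outcome V
    best = outcome (# V) V ≤-refl (allFin⁺ n)

    #V*#V≡n² : # V * # V ≡ n ^ 2
    #V*#V≡n² = trans (cong (λ k → k * k) (length-tabulate {n = n} id)) (cong (n *_) (sym (*-identityʳ n)))

    -- Here `t` comes from a maximum triangle-independent set, and the edges uncut by any colouring
    -- form a set whose deletion leaves a bipartite graph.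
    4[α₁+τB]≤cost : ∀ c → 4 * (α₁ G + τB G) ≤ cost V c
    4[α₁+τB]≤cost c = begin
      4 * (α₁ G + τB G)                       ≡⟨ arith (α₁ G) (τB G) ⟩
      2 * (2 * α₁ G) + 2 * (2 * τB G)
        ≤⟨ +-monoʳ-≤ (2 * (2 * α₁ G)) (*-monoʳ-≤ 2 (*-monoʳ-≤ 2
             (proj₂ (proj₂ (minimumBipartiteDeletion G)) F (uncut-bipartite c)))) ⟩
      2 * (2 * α₁ G) + 2 * (2 * ∣ F ∣)
        ≡⟨ cong₂ (λ k l → 2 * k + 2 * l) (2∣P∣ T) (2∣select∣ (uncut adj c) (uncut-sym adj adj-sym c) (uncut⇒adj c)) ⟩
      cost V c                                ∎
      where
      open ≤-Reasoning
      F = select (uncut adj c)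
      arith : ∀ m o → 4 * (m + o) ≡ 2 * (2 * m) + 2 * (2 * o)
      arith = solve-∀
      uncut⇒adj : ∀ c {x y} → uncut adj c x y ≡ true → adj x y ≡ true
      uncut⇒adj c {x} {y} mono with adj x y
      ... | true = refl

  4[α₁+τB]≤n² : 4 * (α₁ G + τB G) ≤ n ^ 2
  4[α₁+τB]≤n² = ≤-trans (4[α₁+τB]≤cost (proj₁ best)) (≤-trans (cost≤ best) (≤-reflexive #V*#V≡n²))

  private
    -- The enumeration `place` is a bijection from the join to the vertices of `G`; the isomorphism
    -- required is its inverse. Places in different blocks are adjacent, hence distinct.
    blocks⇒join : Blocks V → IsJoinOfCompleteBalancedBipartite G
    blocks⇒join blocks = k , size , positive , record
      { bijection = ↔-sym place↔
      ; adjacency = λ u v → subst₂ (λ x y → Adj G x y ⇔ JoinAdj H (from u) (from v))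
          (Inverse.strictlyInverseˡ place↔ u) (Inverse.strictlyInverseˡ place↔ v)
          (place-adj (from u) (from v))
      }
      where
      open Blocks blocks
      H : ∀ i → Graph (Fin (size i) ⊎ Fin (size i))
      H i = K (size i) (size i)
      W : Set
      W = Σ (Fin k) λ i → Fin (size i) ⊎ Fin (size i)
      place : W → Fin n
      place (i , p) = at i p
      place-injective : ∀ {p q} → place p ≡ place q → p ≡ q
      place-injective {i , p} {j , q} eq with i Fin.≟ j
      ... | yes refl = cong (i ,_) (at-injective i eq)
      ... | no i≢j   = contradiction
        (trans (sym (outer i≢j p q)) (trans (cong (flip adj (at j q)) eq) (adj-irrefl (at j q)))) λ ()
      place↔ : W ↔ Fin n
      place↔ = ⤖⇒↔ (mk⤖ (place-injective , λ x → let i , p , eq = at-onto (∈-allFin x) in (i , p) , λ { refl → eq }))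
      from : Fin n → W
      from = Inverse.from place↔
      place-adj : ∀ p q → Adj G (place p) (place q) ⇔ JoinAdj H p q
      place-adj (i , p) (j , q) with i Fin.≟ j
      ... | no i≢j   = mk⇔ (λ _ → across i≢j) (λ _ → does-true⁻ (at i p ~? at j q) (outer i≢j p q))
      ... | yes refl = mk⇔
        (λ p~q → within (does-true⁻ (adj? (H i) p q) (trans (sym (inner i p q)) (dec-true (at i p ~? at i q) p~q))))
        λ where
          (within p~q) → does-true⁻ (at i p ~? at i q) (trans (inner i p q) (dec-true (adj? (H i) p q) p~q))
          (across i≢i) → contradiction refl i≢i

  -- Equality excludes the strict outcome, and the other one carries the blocks.
  equality⇒join : 4 * (α₁ G + τB G) ≡ n ^ 2 → IsJoinOfCompleteBalancedBipartite G
  equality⇒join eq = from-outcome best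
    where
    from-outcome : Outcome V → IsJoinOfCompleteBalancedBipartite G
    from-outcome (c , inj₁ lt) = contradiction (trans eq (sym #V*#V≡n²)) (<⇒≢ (≤-<-trans (4[α₁+τB]≤cost c) lt))
    from-outcome (c , inj₂ (_ , _ , blocks)) = blocks⇒join blocks

  -- Two vertices of a join of complete bipartite graphs are non-adjacent iff they
  -- lie on the same side of the same factor; T pairs each side with the opposite one.
  module _ {C : Set} (_≟C_ : ∀ (x y : C) → Dec (x ≡ y)) (class : Fin n → C) (opp : C → C)
           (opp-involutive : ∀ x → opp (opp x) ≡ x) (opp-≢ : ∀ x → opp x ≢ x)
           (non-adj : ∀ x y → adj x y ≡ not (does (class x ≟C class y)))
           (σ : Permutation′ n) (class-σ : ∀ x → class (σ ⟨$⟩ʳ x) ≡ opp (class x)) where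
    private
      r : Fin n → Fin n → Bool
      r x y = does (class x ≟C opp (class y))

      r-sym : ∀ x y → r x y ≡ r y x
      r-sym x y = does-⇔ (mk⇔ flipped flipped) (class x ≟C opp (class y)) (class y ≟C opp (class x))
        where
        flipped : ∀ {p q} → p ≡ opp q → q ≡ opp p
        flipped {q = q} refl = sym (opp-involutive q)

      r⇒adj : ∀ {x y} → r x y ≡ true → adj x y ≡ true
      r⇒adj {x} {y} xy = trans (non-adj x y) (cong not (dec-false (class x ≟C class y)
        λ eq → opp-≢ (class y) (trans (sym (does-true⁻ (class x ≟C opp (class y)) xy)) eq)))

      r-walk : ∀ {x y z} → r x y ≡ true → r y z ≡ true → adj x z ≡ false
      r-walk {x} {y} {z} xy yz = trans (non-adj x z) (cong not (dec-true (class x ≟C class z)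
        (trans (does-true⁻ (class x ≟C opp (class y)) xy)
          (trans (cong opp (does-true⁻ (class y ≟C opp (class z)) yz)) (opp-involutive (class z))))))

      -- Since `σ` carries each class to the opposite one, substituting `σ y` for y turns lying in
      -- opposite classes into lying in the same class, which is non-adjacency.
      pairs-r : pairs r V V ≡ pairs (λ x y → not (adj x y)) V V
      pairs-r = ∑-cong {xs = V} λ {x} _ → trans
        (∑-cong {xs = V} λ {y} _ → cong ⟦_⟧ (trans (cong (λ z → does (class x ≟C z)) (sym (class-σ y)))
          (sym (trans (cong not (non-adj x (σ ⟨$⟩ʳ y))) (Bool.not-involutive _)))))
        (sym (∑-permute σ _))

    classes⇒n²≤ : n ^ 2 ≤ 4 * (α₁ G + τB G)
    classes⇒n²≤ = begin
      n ^ 2                                     ≡⟨ #V*#V≡n² ⟨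
      # V * # V                                 ≤⟨ pairs-uncut c adj V ⟩
      2 * pairs (uncut adj c) V V + 2 * pairs (λ x y → not (adj x y)) V V
        ≡⟨ cong (λ k → 2 * pairs (uncut adj c) V V + 2 * k) (trans (sym pairs-r) (sym (2∣select∣ r r-sym r⇒adj))) ⟩
      2 * pairs (uncut adj c) V V + 2 * (2 * ∣ select r ∣)
        ≤⟨ +-mono-≤ (*-monoʳ-≤ 2 (bipartite-uncut bip)) (*-monoʳ-≤ 2 (*-monoʳ-≤ 2
             (proj₂ (proj₂ (maximumTriangleIndependent G)) (select r) (select-independent r r-sym r-walk)))) ⟩
      2 * (2 * ∣ F ∣) + 2 * (2 * α₁ G)         ≡⟨ arith (α₁ G) ∣ F ∣ ⟩
      4 * (α₁ G + ∣ F ∣)                        ∎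
      where
      open ≤-Reasoning
      F : EdgeSet G
      F = proj₁ (minimumBipartiteDeletion G)
      bip : Bipartite (_∖_ G F)
      bip = proj₁ (proj₂ (minimumBipartiteDeletion G))
      c : Fin n → Bool
      c = proj₁ bip
      arith : ∀ m o → 2 * (2 * o) + 2 * (2 * m) ≡ 4 * (m + o)
      arith = solve-∀

  -- The class of a vertex is its factor and side, and `σ` exchanges equally numbered vertices on
  -- the two sides of a factor. This is where balance enters.
  join⇒n²≤ : IsJoinOfCompleteBalancedBipartite G → n ^ 2 ≤ 4 * (α₁ G + τB G)
  join⇒n²≤ (k , size , _ , iso) =
    classes⇒n²≤ (Product.≡-dec Fin._≟_ Bool._≟_) (classW ∘ to) opp opp-involutive opp-≢ non-adj σ class-σ
    where
    open _≅_ iso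
    open Inverse bijection using (to; from; strictlyInverseˡ; strictlyInverseʳ)
    H : ∀ i → Graph (Fin (size i) ⊎ Fin (size i))
    H i = K (size i) (size i)
    W : Set
    W = Σ (Fin k) λ i → Fin (size i) ⊎ Fin (size i)
    isLeft : ∀ {A : Set} → A ⊎ A → Bool
    isLeft = [ const true , const false ]′
    classW : W → Fin k × Bool
    classW (i , p) = i , isLeft p
    opp : Fin k × Bool → Fin k × Bool
    opp (i , b) = i , not b
    opp-involutive : ∀ x → opp (opp x) ≡ x
    opp-involutive (i , b) = cong (i ,_) (Bool.not-involutive b)
    opp-≢ : ∀ x → opp x ≢ x
    opp-≢ (i , b) eq = Bool.not-¬ {b} refl (sym (cong proj₂ eq))
    joinAdj⇒ : ∀ {p q} → JoinAdj H p q → classW p ≢ classW q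
    joinAdj⇒ (within left-right) ()
    joinAdj⇒ (within right-left) ()
    joinAdj⇒ (across i≢j) eq = i≢j (cong proj₁ eq)
    ⇒joinAdj : ∀ p q → classW p ≢ classW q → JoinAdj H p q
    ⇒joinAdj (i , p) (j , q) ≢ with i Fin.≟ j
    ... | no i≢j = across i≢j
    ⇒joinAdj (i , inj₁ _) (i , inj₁ _) ≢ | yes refl = contradiction refl ≢
    ⇒joinAdj (i , inj₁ _) (i , inj₂ _) ≢ | yes refl = within left-right
    ⇒joinAdj (i , inj₂ _) (i , inj₁ _) ≢ | yes refl = within right-left
    ⇒joinAdj (i , inj₂ _) (i , inj₂ _) ≢ | yes refl = contradiction refl ≢
    non-adj : ∀ x y → adj x y ≡ not (does (Product.≡-dec Fin._≟_ Bool._≟_ (classW (to x)) (classW (to y))))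
    non-adj x y with Product.≡-dec Fin._≟_ Bool._≟_ (classW (to x)) (classW (to y))
    ... | yes eq = dec-false (x ~? y) λ x~y → joinAdj⇒ (Equivalence.to (adjacency x y) x~y) eq
    ... | no  ≢  = dec-true (x ~? y) (Equivalence.from (adjacency x y) (⇒joinAdj (to x) (to y) ≢))
    swapW : W → W
    swapW (i , p) = i , swap p
    σ : Permutation′ n
    σ = mk↔ₛ′ σ→ σ→ σσ σσ
      where
      σ→ : Fin n → Fin n
      σ→ = from ∘ swapW ∘ to
      σσ : ∀ x → σ→ (σ→ x) ≡ x
      σσ x = trans (cong (from ∘ swapW) (strictlyInverseˡ (swapW (to x))))
        (trans (cong (λ p → from (proj₁ (to x) , p)) (swap-involutive (proj₂ (to x)))) (strictlyInverseʳ x))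
    class-σ : ∀ x → classW (to (σ ⟨$⟩ʳ x)) ≡ opp (classW (to x))
    class-σ x = trans (cong classW (strictlyInverseˡ (swapW (to x)))) (class-swap (to x))
      where
      class-swap : ∀ p → classW (swapW p) ≡ opp (classW p)
      class-swap (i , inj₁ _) = refl
      class-swap (i , inj₂ _) = refl

theorem4 : ∀ (n : ℕ) (G : Graph (Fin n)) →
    (4 * (α₁ G + τB G) ≤ n ^ 2) ×
    ((4 * (α₁ G + τB G) ≡ n ^ 2) ⇔ IsJoinOfCompleteBalancedBipartite G)
theorem4 n G = 4[α₁+τB]≤n² G ,
  mk⇔ (equality⇒join G) λ join → ≤-antisym (4[α₁+τB]≤n² G) (join⇒n²≤ G join)
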